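{- Let $r$, $d$ and $n$ be positive integers. If $r\ge 2$ and $n\ge 2r$, then there exists a self-centered radially maximal graph of radius $r$ and order $n$. If $r<d\le 2r-2$ and $n\ge 3r-1$, then there exists a radially maximal graph of radius $r$, diameter $d$ and order $n$.
   Context: All graphs are finite and simple. For a connected graph $G$, the eccentricity $e(v)$ of a vertex $v$ is the maximum distance from $v$ to any vertex; the radius ${\rm rad}(G)$ is the minimum eccentricity and the diameter ${\rm diam}(G)$ is the maximum eccentricity. A graph is self-centered if its radius equals its diameter. A graph $G$ is radially maximal if it is not complete and ${\rm rad}(G+e)<{\rm rad}(G)$ for every edge $e$ of the complement of $G$ (i.e., adding any new edge decreases the radius). The order of a graph is its number of vertices. -}

module Defs where

open import Data.Nat using (ℕ; zero; suc; _≤_; _<_)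
open import Data.Fin using (Fin; _≟_)
open import Data.Bool using (Bool; true; false; _∨_; if_then_else_)
open import Data.Bool.Properties using (∨-comm)
open import Data.Product using (Σ; ∃; _×_; _,_)
open import Data.Empty using (⊥)
open import Relation.Nullary using (¬_; Dec; yes; no; does)
open import Relation.Binary.PropositionalEquality using (_≡_; _≢_; refl; sym; cong₂)

record Graph (n : ℕ) : Set where
  field
    adj     : Fin n → Fin n → Bool
    adj-sym : ∀ u v → adj u v ≡ adj v u
    irrefl  : ∀ v → adj v v ≡ false
open Graph public

data Within {n : ℕ} (G : Graph n) : ℕ → Fin n → Fin n → Set where
  here : ∀ {k u} → Within G k u u
  step : ∀ {k u w v} → adj G u w ≡ true → Within G k w v → Within G (suc k) u v

Connected : ∀ {n} → Graph n → Set
Connected G = ∀ u v → ∃ λ k → Within G k u v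

Ecc : ∀ {n} → Graph n → Fin n → ℕ → Set
Ecc G v k = (∀ w → Within G k v w) × (∀ j → j < k → ∃ λ w → ¬ Within G j v w)

HasRadius : ∀ {n} → Graph n → ℕ → Set
HasRadius G r = (∃ λ v → Ecc G v r) × (∀ v k → Ecc G v k → r ≤ k)

HasDiameter : ∀ {n} → Graph n → ℕ → Set
HasDiameter G d = (∃ λ v → Ecc G v d) × (∀ v k → Ecc G v k → k ≤ d)

NotComplete : ∀ {n} → Graph n → Set
NotComplete G = ∃ λ x → ∃ λ y → x ≢ y × adj G x y ≡ false

isPair : ∀ {n} → Fin n → Fin n → Fin n → Fin n → Bool
isPair x y u v = (does (u ≟ x) Data.Bool.∧ does (v ≟ y)) ∨ (does (u ≟ y) Data.Bool.∧ does (v ≟ x))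

private
  isPair-sym : ∀ {n} (x y u v : Fin n) → isPair x y u v ≡ isPair x y v u
  isPair-sym x y u v with u ≟ x | v ≟ y | u ≟ y | v ≟ x
  ... | yes _ | yes _ | yes _ | yes _ = refl
  ... | yes _ | yes _ | yes _ | no  _ = refl
  ... | yes _ | yes _ | no  _ | yes _ = refl
  ... | yes _ | yes _ | no  _ | no  _ = refl
  ... | yes _ | no  _ | yes _ | yes _ = refl
  ... | yes _ | no  _ | yes _ | no  _ = refl
  ... | yes _ | no  _ | no  _ | yes _ = refl
  ... | yes _ | no  _ | no  _ | no  _ = refl
  ... | no  _ | yes _ | yes _ | yes _ = refl
  ... | no  _ | yes _ | yes _ | no  _ = refl
  ... | no  _ | yes _ | no  _ | yes _ = refl
  ... | no  _ | yes _ | no  _ | no  _ = refl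
  ... | no  _ | no  _ | yes _ | yes _ = refl
  ... | no  _ | no  _ | yes _ | no  _ = refl
  ... | no  _ | no  _ | no  _ | yes _ = refl
  ... | no  _ | no  _ | no  _ | no  _ = refl

  isPair-irr : ∀ {n} (x y : Fin n) → x ≢ y → ∀ v → isPair x y v v ≡ false
  isPair-irr x y x≢y v with v ≟ x | v ≟ y
  ... | yes refl | yes refl = Data.Empty.⊥-elim (x≢y refl)
  ... | yes _ | no _ = refl
  ... | no _ | yes _ = refl
  ... | no _ | no _ = refl

  ∨-false : ∀ {a b} → a ≡ false → b ≡ false → (a ∨ b) ≡ false
  ∨-false refl refl = refl

addEdge : ∀ {n} (G : Graph n) (x y : Fin n) → x ≢ y → Graph n
addEdge G x y x≢y = record
  { adj     = λ u v → adj G u v ∨ isPair x y u v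
  ; adj-sym = λ u v → cong₂ _∨_ (adj-sym G u v) (isPair-sym x y u v)
  ; irrefl  = λ v → ∨-false (irrefl G v) (isPair-irr x y x≢y v)
  }

RadiallyMaximal : ∀ {n} → Graph n → Set
RadiallyMaximal G =
  NotComplete G ×
  (∀ x y (x≢y : x ≢ y) → adj G x y ≡ false →
     ∀ r → HasRadius G r →
     ∃ λ r′ → HasRadius (addEdge G x y x≢y) r′ × r′ < r)

{-# OPTIONS --safe #-}
module Submission where

-- Adding edges to a graph G of radius r as long as the radius stays r ends in a radially maximal graph H, and distances
-- in H are at most those in G.  So it suffices to find G of radius r and diameter d such that no supergraph of radius r
-- has smaller diameter.  For d = r the cycle of length 2r, with one vertex multiplied, will do.  For d = r + p with
-- 1 ≤ p ≤ r - 2 we take a cycle of length 2r - 1 with a path of p vertices, r - p - 1 pendant vertices and one further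
-- vertex attached, and measure the level of a vertex by its distance from the end of the path (on the further vertex the
-- level of a neighbour).  An added edge joining levels that differ by at least two creates a vertex of eccentricity less
-- than r, since every cycle vertex had essentially one vertex beyond distance r - 1.  Hence levels change by at most one
-- along the edges of H, and the distance d between the lowest and the highest level survives in H.

open import Defs
open import Data.Bool using (Bool; true; false; _∨_) renaming (_≟_ to _≟ᵇ_)
open import Data.Bool.Properties using (∨-zeroʳ; ∨-comm; ¬-not)
open import Data.Fin using (Fin; zero; toℕ; fromℕ<; splitAt; _↑ʳ_; _≟_)
open import Data.Fin.Properties using (any?; all?; ¬∀⟶∃¬; +↔⊎; splitAt-↑ʳ; toℕ<n; toℕ-fromℕ<; toℕ-injective)
open import Data.List using (List; []; _∷_; cartesianProduct; allFin)
open import Data.List.Membership.Propositional.Properties using (∈-cartesianProduct⁺; ∈-allFin)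
open import Data.List.Relation.Unary.All as All using (All)
open import Data.Nat using (ℕ; zero; suc; pred; _≤_; _<_; _*_; _+_; _∸_; _⊓_; z≤n; s≤s; NonZero)
open import Data.Nat.DivMod
open import Data.Nat.Properties hiding (_≟_)
open import Data.Nat.Properties using () renaming (_≟_ to _≟ⁿ_)
open import Data.Nat.Tactic.RingSolver using (solve)
open import Data.Product using (∃; _×_; _,_; proj₁; proj₂; swap)
open import Data.Sum using (_⊎_; inj₁; inj₂; [_,_]′; map₁) renaming (swap to ⊎-swap)
open import Data.Sum.Function.Propositional using (_⊎-↔_)
open import Function using (_∘_; _↔_; Inverse; Injection)
open import Function.Properties.Inverse using (↔-refl; ↔-trans; ↔⇒↣)
open import Relation.Binary.Definitions using (tri<; tri≈; tri>)
open import Relation.Binary.PropositionalEquality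
open import Relation.Nullary using (¬_; Dec; yes; no; does; contradiction)
open import Relation.Nullary.Decidable using (map′; _×-dec_; _⊎-dec_; dec-yes; dec-true; dec-false)

-- The base graph for d = r + p rests on a count. On a cycle of length 2r - 1, a pendant vertex is
-- beyond distance r - 1 from exactly the two cycle vertices antipodal to its foot; the end of a
-- path of p vertices, from 2p of them; a vertex joined to both ends of an edge, from a single one.
-- Since 2p + 2(r - p - 1) + 1 = 2r - 1, the attachments can be placed so that each cycle vertex is
-- blocked by exactly one of them, and the order is (2r - 1) + p + (r - p - 1) + 1 = 3r - 1. A new
-- edge lowers the radius as soon as it brings one cycle vertex within r - 1 of the attachment
-- blocking it, so each kind of edge only needs a well-chosen cycle vertex. Surplus order is
-- absorbed by non-adjacent twins of one cycle vertex. When d = r no levels are needed: a radius of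
-- at least r forces a diameter of at least r.

-- Supergraphs and walks of bounded length

_⊑_ : ∀ {n} → Graph n → Graph n → Set
G ⊑ H = ∀ u v → adj G u v ≡ true → adj H u v ≡ true

⊑-trans : ∀ {n} {G H K : Graph n} → G ⊑ H → H ⊑ K → G ⊑ K
⊑-trans G⊑H H⊑K u v = H⊑K u v ∘ G⊑H u v

⊑-addEdge : ∀ {n} (G : Graph n) x y x≢y → G ⊑ addEdge G x y x≢y
⊑-addEdge G x y x≢y u v uv rewrite uv = refl

addEdge-mono : ∀ {n} {G H : Graph n} x y x≢y x≢y′ → G ⊑ H → addEdge G x y x≢y ⊑ addEdge H x y x≢y′
addEdge-mono {G = G} {H} x y _ _ G⊑H u v with adj G u v in eq
... | true  = λ _ → cong (_∨ isPair x y u v) (G⊑H u v eq)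
... | false = λ uv → trans (cong (adj H u v ∨_) uv) (∨-zeroʳ (adj H u v))

addEdge-new : ∀ {n} (G : Graph n) x y x≢y → adj (addEdge G x y x≢y) x y ≡ true
addEdge-new G x y x≢y rewrite dec-yes (x ≟ x) refl .proj₂ | dec-yes (y ≟ y) refl .proj₂ =
  ∨-zeroʳ (adj G x y)

module _ {n : ℕ} {G : Graph n} where

  within-weaken : ∀ {j k u v} → j ≤ k → Within G j u v → Within G k u v
  within-weaken _         here       = here
  within-weaken (s≤s j≤k) (step e p) = step e (within-weaken j≤k p)

  within-trans : ∀ {j k u v w} → Within G j u v → Within G k v w → Within G (j + k) u w
  within-trans {j} {k} here q = within-weaken (m≤n+m k j) q
  within-trans (step e p)   q = step e (within-trans p q)

  within-edge : ∀ {u v} → adj G u v ≡ true → Within G 1 u v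
  within-edge e = step e here

  within-sym : ∀ {k u v} → Within G k u v → Within G k v u
  within-sym here = here
  within-sym {suc k} (step {u = u} {w} e p) =
    within-weaken (≤-reflexive (+-comm k 1))
      (within-trans (within-sym p) (within-edge (trans (adj-sym G w u) e)))

within-⊑ : ∀ {n} {G H : Graph n} {k u v} → G ⊑ H → Within G k u v → Within H k u v
within-⊑ G⊑H here       = here
within-⊑ G⊑H (step e p) = step (G⊑H _ _ e) (within-⊑ G⊑H p)

-- A walk of length `k` cannot bridge a difference of more than `k`. Explicit lower bounds on
-- distances are certified by such functions `h` rather than by analysing walks.
within-lipschitz : ∀ {n} {G : Graph n} {h : Fin n → ℕ} → (∀ u v → adj G u v ≡ true → h u ≤ suc (h v)) →
                   ∀ {k u v} → Within G k u v → h u ≤ k + h v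
within-lipschitz lip {k} here  = m≤n+m _ k
within-lipschitz lip (step e p) = ≤-trans (lip _ _ e) (s≤s (within-lipschitz lip p))

within? : ∀ {n} (G : Graph n) k u v → Dec (Within G k u v)
within? G zero u v = map′ (λ { refl → here }) (λ { here → refl }) (u ≟ v)
within? G (suc k) u v =
  map′ (λ { (inj₁ refl) → here ; (inj₂ (_ , e , p)) → step e p })
       (λ { here → inj₁ refl ; (step e p) → inj₂ (_ , e , p) })
       ((u ≟ v) ⊎-dec any? (λ w → (adj G u w ≟ᵇ true) ×-dec within? G k w v))

-- Radius and saturation

-- Radius at most `k`, as a decidable property that passes to supergraphs.
Central : ∀ {n} → Graph n → ℕ → Set
Central G k = ∃ λ v → ∀ w → Within G k v w

central? : ∀ {n} (G : Graph n) k → Dec (Central G k)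
central? G k = any? λ v → all? λ w → within? G k v w

central-weaken : ∀ {n} {G : Graph n} {j k} → j ≤ k → Central G j → Central G k
central-weaken j≤k (v , c) = v , λ w → within-weaken j≤k (c w)

central-⊑ : ∀ {n} {G H : Graph n} {k} → G ⊑ H → Central G k → Central H k
central-⊑ G⊑H (v , c) = v , λ w → within-⊑ G⊑H (c w)

some-beyond : ∀ {n} {G : Graph n} {k v} → ¬ (∀ w → Within G k v w) → ∃ λ w → ¬ Within G k v w
some-beyond {n} {G} {k} {v} = ¬∀⟶∃¬ n (Within G k v) (within? G k v)

hasRadius : ∀ {n} {G : Graph n} {k} → Central G k → (∀ j → j < k → ¬ Central G j) → HasRadius G k
hasRadius (v , c) none =
  (v , c , λ j j<k → some-beyond (λ all → none j j<k (v , all))) ,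
  λ u k (all , _) → ≮⇒≥ (λ k<r → none k k<r (u , all))

radius≤ : ∀ {n} {G : Graph n} k → Central G k → ∃ λ r → HasRadius G r × r ≤ k
radius≤ zero c = zero , hasRadius c (λ _ ()) , z≤n
radius≤ {G = G} (suc k) c with central? G k
... | yes c′ = let r , hr , r≤k = radius≤ k c′ in r , hr , m≤n⇒m≤1+n r≤k
... | no ¬c′ = suc k , hasRadius c (λ { j (s≤s j≤k) cj → ¬c′ (central-weaken j≤k cj) }) , ≤-refl

Saturated : ∀ {n} → Graph n → ℕ → Fin n → Fin n → Set
Saturated H k x y = ∀ x≢y → adj H x y ≡ false → Central (addEdge H x y x≢y) k

-- One pass over the pairs is enough: a pair rejected because it would bring the radius down to `k`
-- stays rejected, since adding it to a later, larger graph gives a supergraph of the one rejected.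
saturate : ∀ {n} k (xys : List (Fin n × Fin n)) (G : Graph n) → ¬ Central G k →
           ∃ λ H → G ⊑ H × ¬ Central H k × All (λ (x , y) → Saturated H k x y) xys
saturate k [] G ¬c = G , (λ _ _ e → e) , ¬c , All.[]
saturate k ((x , y) ∷ xys) G ¬c with x ≟ y
... | yes x≡y =
  let H , G⊑H , ¬cH , sat = saturate k xys G ¬c
  in  H , G⊑H , ¬cH , (λ x≢y → contradiction x≡y x≢y) All.∷ sat
... | no x≢y with central? (addEdge G x y x≢y) k
...   | yes c =
  let H , G⊑H , ¬cH , sat = saturate k xys G ¬c
  in  H , G⊑H , ¬cH , (λ x≢y′ _ → central-⊑ {H = addEdge H x y x≢y′} (addEdge-mono {G = G}
          {H} x y x≢y x≢y′ G⊑H) c) All.∷ sat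
...   | no ¬c′ =
  let H , G⁺⊑H , ¬cH , sat = saturate k xys (addEdge G x y x≢y) ¬c′
      xy∈H = G⁺⊑H x y (addEdge-new G x y x≢y)
  in  H , ⊑-trans {G = G} {addEdge G x y x≢y} {H} (⊑-addEdge G x y x≢y) G⁺⊑H , ¬cH ,
      (λ _ xy∉H → contradiction (trans (sym xy∈H) xy∉H) λ ()) All.∷ sat

Realized : ℕ → ℕ → ℕ → Set
Realized r d n = ∃ λ (G : Graph n) → Connected G × RadiallyMaximal G × HasRadius G r × HasDiameter G d

-- Upper bounds on distances pass from `G` to its saturation, and `¬ Central H k` keeps the radius
-- above `k`. Only the lower bound on the diameter could be lost, so it is asked of every supergraph
-- in which the saturation might end.
radiallyMaximal-above : ∀ {n} (G : Graph n) k d → 1 ≤ d → ¬ Central G k → Central G (suc k) →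
  (∀ u v → Within G (suc d) u v) →
  (∀ H → G ⊑ H → ¬ Central H k → ∃ λ u → ∃ λ v → ¬ Within H d u v) →
  Realized (suc k) (suc d) n
radiallyMaximal-above {n} G k d 1≤d ¬c c close apart =
  let H , G⊑H , ¬cH , sat = saturate k (cartesianProduct (allFin n) (allFin n)) G ¬c
      u , v , far = apart H G⊑H ¬cH
      closeH = λ x y → within-⊑ {H = H} G⊑H (close x y)
      lower = λ r (hr : HasRadius H r) → ≰⇒> {r} {k} λ r≤k →
        let (x , allx , _) , _ = hr in ¬cH (x , λ w → within-weaken r≤k (allx w))
  in  H , (λ x y → suc d , closeH x y) ,
      ( (u , v , (λ u≡v → far (subst (Within H d u) u≡v here)) ,
          ¬-not λ e → far (within-weaken 1≤d (within-edge e)))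
      , λ x y x≢y xy∉H r hr →
          let r′ , hr′ , r′≤k = radius≤ k (All.lookup sat {x , y} (∈-cartesianProduct⁺ (∈-allFin x)
                  (∈-allFin y)) x≢y xy∉H)
          in  r′ , hr′ , ≤-<-trans r′≤k (lower r hr)) ,
      hasRadius (central-⊑ G⊑H c) (λ { j (s≤s j≤k) cj → ¬cH (central-weaken j≤k cj) }) ,
      (u , closeH u , λ { j (s≤s j≤d) → v , λ p → far (within-weaken j≤d p) }) ,
      λ x l (_ , beyond) → ≮⇒≥ λ d<l → let w , notw = beyond (suc d) d<l in notw (closeH x w)

-- Walks between positions, and graphs with twins

-- `W k a b` stands for distance at most `k` between positions. Abstracting from the graph lets one
-- construction of walks serve the base graph, all its supergraphs and every choice of
-- representatives among twins.
record Reach {V : Set} (OK : V → Set) (St : V → V → Set) (W : ℕ → V → V → Set) : Set where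
  field
    stay   : ∀ {k a} → W k a a
    _▷_    : ∀ {j k a b c} → W j a b → W k b c → W (j + k) a c
    back   : ∀ {k a b} → W k a b → W k b a
    weaken : ∀ {j k a b} → j ≤ k → W j a b → W k a b
    link   : ∀ {a b} → OK a → OK b → St a b → W 1 a b
  infixr 5 _▷_

Lipschitz : {V : Set} → (V → V → Set) → (V → ℕ) → Set
Lipschitz St g = ∀ {a b} → St a b → g a ≤ suc (g b) × g b ≤ suc (g a)

module Pullback {V : Set} (_≟ⱽ_ : ∀ (a b : V) → Dec (a ≡ b)) {OK : V → Set} {St : V → V → Set}
  (St? : ∀ a b → Dec (St a b)) (St-irrefl : ∀ a → ¬ St a a)
  {n : ℕ} (φ : Fin n → V) (φ-OK : ∀ i → OK (φ i)) where

  graph : Graph n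
  graph = record
    { adj     = λ u v → does (St? (φ u) (φ v)) ∨ does (St? (φ v) (φ u))
    ; adj-sym = λ u v → ∨-comm (does (St? (φ u) (φ v))) _
    ; irrefl  = λ v → cong (λ b → b ∨ b) (dec-false (St? (φ v) (φ v)) (St-irrefl (φ v)))
    }

  edge : ∀ {u v} → St (φ u) (φ v) → adj graph u v ≡ true
  edge {u} {v} s = cong (_∨ does (St? (φ v) (φ u))) (dec-true (St? (φ u) (φ v)) s)

  graph-lipschitz : ∀ {g} → Lipschitz St g → ∀ u v → adj graph u v ≡ true → g (φ u) ≤ suc (g (φ v))
  graph-lipschitz lip u v e with St? (φ u) (φ v) | St? (φ v) (φ u)
  ... | yes s | _     = lip s .proj₁
  ... | no _  | yes s = lip s .proj₂
  graph-lipschitz lip u v () | no _ | no _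

  Section : (V → Fin n) → Set
  Section ρ = ∀ {a} → OK a → φ (ρ a) ≡ a

  -- Makes `x` the representative of its own position, as is needed when an edge at `x` or a
  -- distance from `x` is at stake.
  _fixing_ : (V → Fin n) → Fin n → V → Fin n
  (ρ fixing x) a with a ≟ⱽ φ x
  ... | yes _ = x
  ... | no _  = ρ a

  fixing-section : ∀ {ρ} x → Section ρ → Section (ρ fixing x)
  fixing-section x sec {a} ok with a ≟ⱽ φ x
  ... | yes a≡φx = sym a≡φx
  ... | no _     = sec ok

  fixing-at : ∀ ρ x → (ρ fixing x) (φ x) ≡ x
  fixing-at ρ x with φ x ≟ⱽ φ x
  ... | yes _ = refl
  ... | no ≢  = contradiction refl ≢

  fixing-off : ∀ ρ x {a} → a ≢ φ x → (ρ fixing x) a ≡ ρ a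
  fixing-off ρ x {a} a≢φx with a ≟ⱽ φ x
  ... | yes a≡φx = contradiction a≡φx a≢φx
  ... | no _     = refl

  section : (∀ {a} → OK a → ∃ λ i → φ i ≡ a) → Fin n → ∃ Section
  section onto i₀ = ρ , λ {a} ok → sec a ok
    where
    ρ : V → Fin n
    ρ a with any? (λ i → φ i ≟ⱽ a)
    ... | yes (i , _) = i
    -- A dummy value: `Section` constrains `OK` positions only.
    ... | no _        = i₀
    sec : ∀ a → OK a → φ (ρ a) ≡ a
    sec a ok with any? (λ i → φ i ≟ⱽ a)
    ... | yes (_ , φi≡a) = φi≡a
    ... | no ∄i          = contradiction (onto ok) ∄i

  module _ {H : Graph n} (G⊑H : graph ⊑ H) where

    Via : (V → Fin n) → ℕ → V → V → Set
    Via ρ k a b = Within H k (ρ a) (ρ b)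

    reach : ∀ {ρ} → Section ρ → Reach OK St (Via ρ)
    reach sec = record
      { stay = here ; _▷_ = within-trans ; back = within-sym ; weaken = within-weaken
      ; link = λ a b s → within-edge (G⊑H _ _ (edge (subst₂ St (sym (sec a)) (sym (sec b)) s))) }

    -- Vertices at distinct positions can be made representatives simultaneously; twins cannot,
    -- hence the separate bound 2 for them.
    spread : ∀ {k} {ρ} → Section ρ → 2 ≤ k → (∀ i j → φ i ≡ φ j → Within H 2 i j) →
             ∀ i j → (∀ {ρ} → Section ρ → Via ρ k (φ i) (φ j)) → Within H k i j
    spread {k} {ρ} sec 2≤k twins i j via with φ i ≟ⱽ φ j
    ... | yes φi≡φj = within-weaken 2≤k (twins i j φi≡φj)
    ... | no φi≢φj  =
      subst₂ (Within H k) (fixing-at (ρ fixing j) i)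
        (trans (fixing-off (ρ fixing j) i (φi≢φj ∘ sym)) (fixing-at ρ j))
        (via (fixing-section {ρ fixing j} i (fixing-section {ρ} j sec)))

-- Linear arithmetic

_⊹_ : ∀ {a b c d} → a ≤ b → c ≤ d → a + c ≤ b + d
_⊹_ = +-mono-≤
infixr 5 _⊹_

-- An inequality is deduced from a sum l ≤ r of hypotheses and a slack k; what remains is a semiring identity.
by : ∀ {a b l r} k → l ≤ r → b + l ≡ a + r + k → a ≤ b
by {a} {b} {l} {r} k l≤r e = +-cancelʳ-≤ l a b
  (≤-trans (+-monoʳ-≤ a l≤r) (≤-trans (m≤m+n (a + r) k) (≤-reflexive (sym e))))

slack : ∀ {a b} k → b ≡ a + k → a ≤ b
slack {a} k refl = m≤m+n a k

-- Distances on a cycle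

module Ring (m : ℕ) .{{_ : NonZero m}} where

  c : ℕ → ℕ
  c t = t % m

  Next : ℕ → ℕ → Set
  Next a b = b ≡ suc a % m

  next? : ∀ a b → Dec (Next a b)
  next? a b = b ≟ⁿ suc a % m

  c<m : ∀ t → c t < m
  c<m t = m%n<n t m

  c-id : ∀ {b} → b < m → c b ≡ b
  c-id = m<n⇒m%n≡m

  c-period : ∀ {t u} → t ≡ u + m → c t ≡ c u
  c-period {u = u} refl = [m+n]%n≡m%n u m

  c-+ : ∀ a t → c (a + c t) ≡ c (a + t)
  c-+ a t = trans (%-distribˡ-+ a (c t) m)
    (trans (cong (λ x → c (c a + x)) (m%n%n≡m%n t m)) (sym (%-distribˡ-+ a t m)))

  next : ∀ t → Next (c t) (c (suc t))
  next t = sym (c-+ 1 t)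

  next-irrefl : 1 < m → ∀ {a} → ¬ Next a a
  next-irrefl 1<m {a} e with m≤n⇒m<n∨m≡n (subst (_< m) (sym e) (c<m (suc a)))
  ... | inj₁ sa<m = contradiction (sym (trans e (c-id sa<m))) 1+n≢n
  ... | inj₂ refl = contradiction (trans e (n%n≡0 (suc a) ⦃ _ ⦄)) λ { refl → contradiction 1<m (<-irrefl refl) }

  module Walk {W : ℕ → ℕ → ℕ → Set} (reach : Reach (_< m) Next W) where
    open Reach reach

    ahead : ∀ k t → W k (c t) (c (t + k))
    ahead zero t = subst (λ u → W 0 (c t) (c u)) (sym (+-identityʳ t)) stay
    ahead (suc k) t = subst (λ u → W (suc k) (c t) (c u)) (sym (+-suc t k))
      (link (c<m t) (c<m (suc t)) (next t) ▷ ahead k (suc t))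

    between : ∀ {k} t u → t ≤ u → u ≤ t + k → W k (c t) (c u)
    between t _ t≤u u≤t+k with m≤n⇒∃[o]m+o≡n t≤u
    ... | j , refl = weaken (+-cancelˡ-≤ t _ _ u≤t+k) (ahead j t)

    half-≤ : ∀ {h a b} → m ≤ suc (h + h) → a ≤ b → b < m → W h (c a) (c b)
    half-≤ {h} {a} {b} m≤ a≤b b<m with ≤-<-connex b (a + h)
    ... | inj₁ b≤a+h = between a b a≤b b≤a+h
    -- The forward arc is too long; the arc from `b` on to the next copy `a + m` of `a` has length
    -- at most m - (h + 1), hence at most `h`.
    ... | inj₂ a+h<b = back (subst (W h (c b)) (c-period {a + m} refl)
      (between b (a + m) (by {b} {a + m} (a + 1) b<m (solve (a ∷ b ∷ m ∷ []))) (by {a + m} {b + h} 0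
          (a+h<b ⊹ m≤) (solve (a ∷ b ∷ h ∷ m ∷ [])))))

    half : ∀ {h a b} → m ≤ suc (h + h) → a < m → b < m → W h a b
    half {h} {a} {b} m≤ a<m b<m = subst₂ (W h) (c-id a<m) (c-id b<m) ab
      where
      ab : W h (c a) (c b)
      ab with ≤-total a b
      ... | inj₁ a≤b = half-≤ m≤ a≤b b<m
      ... | inj₂ b≤a = back (half-≤ m≤ b≤a a<m)

  -- The cyclic distance from 0 to `x`, for `x` at most `m`.
  tri : ℕ → ℕ
  tri x = x ⊓ (m ∸ x)

  tri-≥ : ∀ {h x} → h ≤ x → x + h ≤ m → h ≤ tri x
  tri-≥ {h} {x} h≤x x+h≤m = ⊓-glb h≤x (m+n≤o⇒m≤o∸n h (subst (_≤ m) (+-comm x h) x+h≤m))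

  tri-suc : ∀ {x} → x < m → tri x ≤ suc (tri (c (suc x))) × tri (c (suc x)) ≤ suc (tri x)
  tri-suc {x} x<m with m≤n⇒m<n∨m≡n x<m
  ... | inj₁ sx<m rewrite c-id sx<m =
    ⊓-mono-≤ (≤-trans (n≤1+n x) (n≤1+n (suc x))) (m≤n+o⇒m∸n≤o m x
      (≤-reflexive (sym (trans (+-suc x (m ∸ suc x)) (m+[n∸m]≡n (<⇒≤ sx<m)))))) ,
    ⊓-monoʳ-≤ (suc x) (≤-trans (∸-monoʳ-≤ m (n≤1+n x)) (n≤1+n _))
  ... | inj₂ refl rewrite n%n≡0 (suc x) ⦃ _ ⦄ =
    ≤-trans (m⊓n≤n x _) (≤-reflexive (m+n∸n≡m 1 x)) , z≤n

  -- Since L + pred m * L is a multiple of m, this is the cyclic distance from L.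
  pot : ℕ → ℕ → ℕ
  pot L b = tri (c (b + pred m * L))

  c-turn : ∀ L x → c (L + x + pred m * L) ≡ c x
  c-turn L x = trans (cong c (trans (cong (_+ pred m * L) (+-comm L x)) (trans (+-assoc x L _)
    (cong (x +_) (trans (cong (λ k → k * L) (suc-pred m)) (*-comm m L)))))) ([m+kn]%n≡m%n x L m)

  pot-at : ∀ L {x} → x < m → pot L (c (L + x)) ≡ tri x
  pot-at L {x} x<m = cong tri (trans
    (trans (cong c (+-comm (c (L + x)) _)) (trans (c-+ (pred m * L) (L + x)) (cong c (+-comm (pred m * L) _))))
    (trans (c-turn L x) (c-id x<m)))

  pot-self : ∀ L → pot L (c L) ≡ 0
  pot-self L = trans (cong (pot L ∘ c) (sym (+-identityʳ L))) (pot-at L (≤-<-trans z≤n (c<m 0)))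

  -- The equation puts `τ` at offset `x` after `L` modulo `m`, without truncated subtraction.
  pot-≥ : ∀ {h} τ L x → τ + m ≡ L + x → h ≤ x → x + h ≤ m → x < m → h ≤ pot L (c τ)
  pot-≥ {h} τ L x e h≤x x+h≤m x<m =
    subst (h ≤_) (sym (trans (cong (pot L) (trans (sym (c-period {u = τ} refl)) (cong c e))) (pot-at L x<m)))
        (tri-≥ h≤x x+h≤m)

  -- Matching on a chart replaces a cycle position by its offset `x` from `L`, and its distance from
  -- `L` by `tri x`.
  data Chart (L : ℕ) : ℕ → Set where
    chart : ∀ x → x < m → pot L (c (L + x)) ≡ tri x → Chart L (c (L + x))

  chart-of : ∀ L {b} → b < m → Chart L b
  chart-of L {b} b<m = subst (Chart L) eq (chart x (c<m _) (pot-at L (c<m _)))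
    where
    x = c (b + pred m * L)
    eq : c (L + x) ≡ b
    eq = trans (c-+ L _) (trans (cong c (sym (+-assoc L b _)))
      (trans (c-turn L b) (c-id b<m)))

  pot-lipschitz : ∀ L → Lipschitz Next (pot L)
  pot-lipschitz L {a} refl = subst (λ y → tri x ≤ suc (tri y) × tri y ≤ suc (tri x)) eq (tri-suc (c<m _))
    where
    x = c (a + pred m * L)
    eq : c (suc x) ≡ c (c (suc a) + pred m * L)
    eq = trans (c-+ 1 (a + pred m * L)) (sym (trans (cong c (+-comm (c (suc a)) _))
      (trans (c-+ (pred m * L) (suc a)) (cong c (+-comm (pred m * L) (suc a))))))

-- The base graph for diameter r + p, where p = suc q, r = suc R and s = r - p - 2: a cycle of odd length m = 2r - 1;
-- a path of p vertices attached at P; a vertex, the apex, adjacent to both ends of the edge {X, X + 1}; and pendant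
-- vertices attached at L 0, …, L s.  Positions on the cycle are read modulo m.  The choice makes every cycle vertex τ
-- miss, within distance R, exactly one of these attachments: the path for 0 ≤ τ < 2p, the apex for τ = 2p and the j-th
-- pendant for τ = 2p + 1 + 2j and τ = 2p + 2 + 2j.
module Sun (q s R m : ℕ) .{{_ : NonZero m}} (R≡ : R ≡ q + s + 2) (m≡ : m ≡ suc (R + R)) where
  open Ring m

  R-≤ : R ≤ q + s + 2
  R-≤ = ≤-reflexive R≡

  R-≥ : q + s + 2 ≤ R
  R-≥ = ≤-reflexive (sym R≡)

  m-≤ : m ≤ suc (R + R)
  m-≤ = ≤-reflexive m≡

  m-≥ : suc (R + R) ≤ m
  m-≥ = ≤-reflexive (sym m≡)

  P X : ℕ
  P = suc (q + R)
  X = q + q + 2 + R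

  -- `L j` is X + 2 + 2j: the feet are two apart because each pendant blocks the two positions
  -- antipodal to its foot. Likewise `X` and X + 1 are the two antipodes of 2p, and `P` is antipodal
  -- to `q` and q + 1, the middle of the positions blocked by the path.
  L : ℕ → ℕ
  L j = q + q + (j + j) + R + 4

  data Vertex : Set where
    cyc leg pend : ℕ → Vertex
    apex : Vertex

  data OK : Vertex → Set where
    cyc  : ∀ {b} → b < m → OK (cyc b)
    leg  : ∀ {i} → i ≤ q → OK (leg i)
    apex : OK apex
    pend : ∀ {j} → j ≤ s → OK (pend j)

  data St : Vertex → Vertex → Set where
    ring  : ∀ {a b} → Next a b → St (cyc a) (cyc b)
    root  : ∀ {a} → a ≡ c P → St (cyc a) (leg 0)
    climb : ∀ {i} → St (leg i) (leg (suc i))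
    apex₁ : ∀ {a} → a ≡ c X → St (cyc a) apex
    apex₂ : ∀ {a} → a ≡ c (suc X) → St (cyc a) apex
    twig  : ∀ {a j} → a ≡ c (L j) → St (cyc a) (pend j)

  _≟ⱽ_ : ∀ (a b : Vertex) → Dec (a ≡ b)
  cyc a  ≟ⱽ cyc b  = map′ (cong cyc) (λ { refl → refl }) (a ≟ⁿ b)
  leg i  ≟ⱽ leg j  = map′ (cong leg) (λ { refl → refl }) (i ≟ⁿ j)
  pend i ≟ⱽ pend j = map′ (cong pend) (λ { refl → refl }) (i ≟ⁿ j)
  apex   ≟ⱽ apex   = yes refl
  cyc _  ≟ⱽ leg _  = no λ ()
  cyc _  ≟ⱽ pend _ = no λ ()
  cyc _  ≟ⱽ apex   = no λ ()
  leg _  ≟ⱽ cyc _  = no λ ()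
  leg _  ≟ⱽ pend _ = no λ ()
  leg _  ≟ⱽ apex   = no λ ()
  pend _ ≟ⱽ cyc _  = no λ ()
  pend _ ≟ⱽ leg _  = no λ ()
  pend _ ≟ⱽ apex   = no λ ()
  apex   ≟ⱽ cyc _  = no λ ()
  apex   ≟ⱽ leg _  = no λ ()
  apex   ≟ⱽ pend _ = no λ ()

  St? : ∀ a b → Dec (St a b)
  St? (cyc a) (cyc b)       = map′ ring (λ { (ring e) → e }) (next? a b)
  St? (cyc a) (leg zero)    = map′ root (λ { (root e) → e }) (a ≟ⁿ c P)
  St? (cyc a) (leg (suc _)) = no λ ()
  St? (cyc a) apex          = map′ (λ { (inj₁ e) → apex₁ e ; (inj₂ e) → apex₂ e })
    (λ { (apex₁ e) → inj₁ e ; (apex₂ e) → inj₂ e }) ((a ≟ⁿ c X) ⊎-dec (a ≟ⁿ c (suc X)))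
  St? (cyc a) (pend j)      = map′ twig (λ { (twig e) → e }) (a ≟ⁿ c (L j))
  St? (leg i) (leg j)       = map′ (λ { refl → climb }) (λ { climb → refl }) (j ≟ⁿ suc i)
  St? (leg _) (cyc _)       = no λ ()
  St? (leg _) apex          = no λ ()
  St? (leg _) (pend _)      = no λ ()
  St? apex _                = no λ ()
  St? (pend _) _            = no λ ()

  1<m : 1 < m
  1<m = (by {suc 1} {m} (R + q + s + 1) (R-≥ ⊹ m-≥) (solve (R ∷ m ∷ q ∷ s ∷ [])))

  St-irrefl : ∀ a → ¬ St a a
  St-irrefl (cyc a) (ring e) = next-irrefl 1<m e

  base : Vertex → ℕ
  base (cyc b)  = b
  base (leg _)  = c P
  base apex     = c X
  base (pend j) = c (L j)

  base<m : ∀ {w} → OK w → base w < m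
  base<m (cyc b<m)        = b<m
  base<m (leg _)          = c<m P
  base<m apex             = c<m X
  base<m (pend {j = j} _) = c<m (L j)

  base-lipschitz : ∀ {h} → Lipschitz Next h → Lipschitz St (h ∘ base)
  base-lipschitz lip (ring e)             = lip e
  base-lipschitz lip (root refl)          = n≤1+n _ , n≤1+n _
  base-lipschitz lip climb                = n≤1+n _ , n≤1+n _
  base-lipschitz lip (apex₁ refl)         = n≤1+n _ , n≤1+n _
  base-lipschitz lip (apex₂ refl)         = swap (lip (next X))
  base-lipschitz lip (twig refl)          = n≤1+n _ , n≤1+n _

  level : Vertex → ℕ
  level (cyc b)  = suc q + pot P b
  level (leg i)  = q ∸ i
  level apex     = suc q + pot P (c X)
  level (pend j) = suc (suc q + pot P (c (L j)))

  level-lipschitz : Lipschitz St level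
  level-lipschitz (ring e) = let below , above = pot-lipschitz P e in lift below , lift above
    where
    lift : ∀ {x y} → x ≤ suc y → suc q + x ≤ suc (suc q + y)
    lift {y = y} x≤sy = ≤-trans (+-monoʳ-≤ (suc q) x≤sy) (≤-reflexive (+-suc (suc q) y))
  level-lipschitz (root refl) rewrite pot-self P | +-identityʳ q = ≤-refl , ≤-trans (n≤1+n q) (n≤1+n _)
  level-lipschitz (climb {i}) =
    m≤n+o⇒m∸n≤o q i (≤-trans (m≤n+m∸n q (suc i)) (≤-reflexive (sym (+-suc i _)))) ,
    ≤-trans (∸-monoʳ-≤ q (n≤1+n i)) (n≤1+n _)
  level-lipschitz (apex₁ refl) = n≤1+n _ , n≤1+n _
  level-lipschitz (apex₂ refl) = swap (level-lipschitz {cyc (c X)} (ring (next X)))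
  level-lipschitz (twig refl)  = ≤-trans (n≤1+n _) (n≤1+n _) , ≤-refl

  -- Lower bound on the radius

  -- A certificate for distances from the apex or a pendant `e`, made from a function `h` on the
  -- cycle that vanishes at the feet of `e`.
  rise : Vertex → (ℕ → ℕ) → Vertex → ℕ
  rise e h w with w ≟ⱽ e
  ... | yes _ = 0
  ... | no _  = suc (h (base w))

  rise-at : ∀ e h → rise e h e ≡ 0
  rise-at e h with e ≟ⱽ e
  ... | yes _ = refl
  ... | no ≢  = contradiction refl ≢

  rise-off : ∀ {e w} h → h (base e) ≡ 0 → 0 < h (base w) → rise e h w ≡ suc (h (base w))
  rise-off {e} {w} h he hw with w ≟ⱽ e
  ... | yes refl = contradiction (subst (0 <_) he hw) λ ()
  ... | no _     = refl

  rise-lipschitz : ∀ {e h} → Lipschitz Next h → (∀ {a} → St a e → h (base a) ≡ 0) → (∀ {b} → ¬ St e b) →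
                   Lipschitz St (rise e h)
  rise-lipschitz {e} lip around out {a} {b} st with a ≟ⱽ e | b ≟ⱽ e
  ... | yes refl | _        = contradiction st out
  ... | no _     | yes refl rewrite around st = ≤-refl , z≤n
  ... | no _     | no _     = let below , above = base-lipschitz lip st in s≤s below , s≤s above

  parity : ∀ y → ∃ λ j → y ≡ j + j ⊎ y ≡ suc (j + j)
  parity zero    = 0 , inj₁ refl
  parity (suc y) with parity y
  ... | j , inj₁ refl = j , inj₂ refl
  ... | j , inj₂ refl = suc j , inj₁ (cong suc (sym (+-suc j j)))

  -- A vertex off the cycle does no better than its foot, so the foot decides which attachment is
  -- missed. The certificate is `level` for the end of the path and `rise` for the apex and the
  -- pendants.
  far : ∀ {w} → OK w → ∃ λ e → OK e × ∃ λ g → Lipschitz St g × g e ≡ 0 × R < g w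
  far {w} ok with ≤-<-connex (q + q + 2) (base w)
  ... | inj₂ τ<2p = leg q , leg ≤-refl , level , level-lipschitz , n∸n≡0 q , high ok τ<2p
    where
    reaches : ∀ {τ} → τ < q + q + 2 → τ < m → s + 2 ≤ pot P τ
    reaches {τ} τ<2p τ<m = subst (λ t → s + 2 ≤ pot P t) (c-id τ<m) (pot-≥ τ P (τ + s + 2)
      (≤-antisym (by {τ + m} {(suc (q + R)) + (τ + s + 2)} 0 (R-≤ ⊹ m-≤) (solve (R ∷ m ∷ q ∷ s ∷ τ ∷ [])))
          (by {(suc (q + R)) + (τ + s + 2)} {τ + m} 0 (R-≥ ⊹ m-≥) (solve (R ∷ m ∷ q ∷ s ∷ τ ∷ []))))
          (slack {s + 2} {τ + s + 2} τ (solve (s ∷ τ ∷ [])))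
      (by {τ + s + 2 + (s + 2)} {m} 0 (τ<2p ⊹ R-≥ ⊹ R-≥ ⊹ m-≥) (solve (R ∷ m ∷ q ∷ s ∷ τ ∷ [])))
          (by {suc (τ + s + 2)} {m} (s + 1) (τ<2p ⊹ R-≥ ⊹ R-≥ ⊹ m-≥) (solve (R ∷ m ∷ q ∷ s ∷ τ ∷ []))))
    above : ∀ {t} → s + 2 ≤ t → R < suc q + t
    above {t} s+2≤t = (by {suc R} {(suc q) + t} 0 (s+2≤t ⊹ R-≤) (solve (R ∷ q ∷ s ∷ t ∷ [])))
    high : ∀ {w} → OK w → base w < q + q + 2 → R < level w
    high (cyc b<m) τ<2p = above (reaches τ<2p b<m)
    -- The foot of the path is `P`, which is at least 2p.
    high (leg {i} _) τ<2p = contradiction (subst (_< q + q + 2) (c-id (by {suc (suc (q + R))} {m} (s + 1)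
        (R-≥ ⊹ m-≥) (solve (R ∷ m ∷ q ∷ s ∷ [])))) τ<2p)
      (≤⇒≯ (by {q + q + 2} {suc (q + R)} (s + 1) R-≥ (solve (R ∷ q ∷ s ∷ []))))
    high apex τ<2p = above (reaches τ<2p (c<m X))
    high (pend {j} _) τ<2p = m≤n⇒m≤1+n (above (reaches τ<2p (c<m (L j))))
  ... | inj₁ 2p≤τ with m≤n⇒∃[o]m+o≡n 2p≤τ
  ...   | zero , 2p≡τ = apex , apex , rise apex h ,
            rise-lipschitz h-lip (λ { (apex₁ refl) → at-X ; (apex₂ refl) → at-sX }) (λ ()) ,
            rise-at apex h , subst (R <_)
                (sym (rise-off {apex} {w} h at-X (≤-trans (≤-trans (s≤s z≤n) (by {1} {R} (q + s + 1) R-≥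
                (solve (R ∷ q ∷ s ∷ [])))) reaches))) (s≤s reaches)
    where
    h : ℕ → ℕ
    h t = pot X t ⊓ pot (suc X) t
    h-lip : Lipschitz Next h
    h-lip e = let b₁ , a₁ = pot-lipschitz X e ; b₂ , a₂ = pot-lipschitz (suc X) e
              in  ⊓-mono-≤ b₁ b₂ , ⊓-mono-≤ a₁ a₂
    at-X : h (c X) ≡ 0
    at-X rewrite pot-self X = refl
    at-sX : h (c (suc X)) ≡ 0
    at-sX rewrite pot-self (suc X) = ⊓-zeroʳ _
    τ = q + q + 2 + 0
    reaches : R ≤ h (base w)
    reaches = subst (λ t → R ≤ h t) (trans (cong c 2p≡τ) (c-id (base<m ok)))
      (⊓-glb (pot-≥ τ X (suc R) (≤-antisym (by {q + q + 2 + 0 + m} {(q + q + 2 + R) + (suc R)} 0 m-≤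
          (solve (R ∷ m ∷ q ∷ []))) (by {(q + q + 2 + R) + (suc R)} {q + q + 2 + 0 + m} 0 m-≥
          (solve (R ∷ m ∷ q ∷ [])))) (n≤1+n R) (by {(suc R) + R} {m} 0 m-≥ (solve (R ∷ m ∷ [])))
          (by {suc (suc R)} {m} (q + s + 1) (R-≥ ⊹ m-≥) (solve (R ∷ m ∷ q ∷ s ∷ []))))
             (pot-≥ τ (suc X) R (≤-antisym (by {q + q + 2 + 0 + m} {(suc (q + q + 2 + R)) + R} 0 m-≤
                 (solve (R ∷ m ∷ q ∷ []))) (by {(suc (q + q + 2 + R)) + R} {q + q + 2 + 0 + m} 0 m-≥
                 (solve (R ∷ m ∷ q ∷ [])))) ≤-refl (by {R + R} {m} 1 m-≥ (solve (R ∷ m ∷ [])))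
                 (by {suc R} {m} R m-≥ (solve (R ∷ m ∷ [])))))
  -- The positions after 2p are shared out in consecutive pairs, the j-th pair to the j-th pendant.
  ...   | suc y , 2p+y≡τ with parity y
  ...     | j , y≡ = pend j , pend j≤s , rise (pend j) (pot (L j)) ,
            rise-lipschitz (pot-lipschitz (L j)) (λ { (twig refl) → pot-self (L j) }) (λ ()) ,
            rise-at (pend j) _ ,
            subst (R <_) (sym (rise-off {pend j} {w} (pot (L j)) (pot-self (L j))
                (≤-trans (≤-trans (s≤s z≤n) (by {1} {R} (q + s + 1) R-≥ (solve (R ∷ q ∷ s ∷ [])))) reaches)))
                (s≤s reaches)
    where
    τ = base w
    j+j≤y : ∀ {y} → y ≡ j + j ⊎ y ≡ suc (j + j) → j + j ≤ y
    j+j≤y (inj₁ refl) = ≤-refl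
    j+j≤y (inj₂ refl) = n≤1+n _
    j≤s : j ≤ s
    j≤s = ≮⇒≥ λ (s<j : s < j) → contradiction (base<m ok) (≤⇒≯ (subst (m ≤_) 2p+y≡τ
      (by {m} {q + q + 2 + (suc y)} 0 ((j+j≤y y≡) ⊹ s<j ⊹ s<j ⊹ R-≤ ⊹ R-≤ ⊹ m-≤)
          (solve (R ∷ j ∷ m ∷ q ∷ s ∷ y ∷ [])))))
    reaches : R ≤ pot (L j) τ
    reaches = subst (λ t → R ≤ pot (L j) t) (trans (cong c 2p+y≡τ) (c-id (base<m ok))) (at y≡)
      where
      at : y ≡ j + j ⊎ y ≡ suc (j + j) → R ≤ pot (L j) (c (q + q + 2 + suc y))
      at (inj₁ e) = pot-≥ _ (L j) R (≤-antisym (by {q + q + 2 + (suc y) + m} {(q + q + (j + j) + R + 4) + R} 0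
          (≤-reflexive e ⊹ m-≤) (solve (R ∷ j ∷ m ∷ q ∷ y ∷ []))) (by {(q + q + (j + j) + R + 4) + R}
          {q + q + 2 + (suc y) + m} 0 (≤-reflexive (sym e) ⊹ m-≥) (solve (R ∷ j ∷ m ∷ q ∷ y ∷ [])))) ≤-refl
          (by {R + R} {m} 1 m-≥ (solve (R ∷ m ∷ []))) (by {suc R} {m} R m-≥ (solve (R ∷ m ∷ [])))
      at (inj₂ e) = pot-≥ _ (L j) (suc R) (≤-antisym (by {q + q + 2 + (suc y) + m} {(q + q + (j + j) + R + 4) +
          (suc R)} 0 (≤-reflexive e ⊹ m-≤) (solve (R ∷ j ∷ m ∷ q ∷ y ∷ [])))
          (by {(q + q + (j + j) + R + 4) + (suc R)} {q + q + 2 + (suc y) + m} 0 (≤-reflexive (sym e) ⊹ m-≥)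
          (solve (R ∷ j ∷ m ∷ q ∷ y ∷ [])))) (n≤1+n R)
        (by {(suc R) + R} {m} 0 m-≥ (solve (R ∷ m ∷ []))) (by {suc (suc R)} {m} (q + s + 1) (R-≥ ⊹ m-≥)
            (solve (R ∷ m ∷ q ∷ s ∷ [])))

  -- Steep pairs, and the top of the level function

  -- Evaluates `tri` without its minimum: a position lies at most `R` after the origin, or `b` steps
  -- before it with `b` at most `R`.
  data Side : ℕ → ℕ → Set where
    right : ∀ {x} → x ≤ R → Side x x
    left  : ∀ {x b} → x + b ≡ m → b ≤ R → Side x b

  side : ∀ {x} → x < m → Side x (tri x)
  side {x} x<m with ≤-<-connex x R | m≤n⇒∃[o]m+o≡n (<⇒≤ x<m)
  ... | inj₁ x≤R | b , x+b≡m = subst (Side x)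
      (sym (m≤n⇒m⊓n≡m (m+n≤o⇒m≤o∸n x (by {x + x} {m} 1 (x≤R ⊹ x≤R ⊹ m-≥) (solve (R ∷ m ∷ x ∷ []))))))
      (right x≤R)
  ... | inj₂ R<x | b , x+b≡m = subst (Side x) (sym (trans (cong (x ⊓_) m∸x≡b) (m≥n⇒m⊓n≡n
      (by {b} {x} 1 (R<x ⊹ R<x ⊹ ≤-reflexive x+b≡m ⊹ m-≤) (solve (R ∷ b ∷ m ∷ x ∷ []))))))
          (left x+b≡m (by {b} {R} 0 (R<x ⊹ ≤-reflexive x+b≡m ⊹ m-≤) (solve (R ∷ b ∷ m ∷ x ∷ []))))
    where
    m∸x≡b : m ∸ x ≡ b
    m∸x≡b = trans (cong (_∸ x) (sym x+b≡m)) (m+n∸m≡n x b)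

  n+2≰1+n : ∀ n → ¬ n + 2 ≤ suc n
  n+2≰1+n n = subst (λ k → ¬ k ≤ suc n) (+-comm 2 n) 1+n≰n

  Steep : Vertex → Vertex → Set
  Steep a b = level a + 2 ≤ level b ⊎ level b + 2 ≤ level a

  steep-St : ∀ {a b} → Steep a b → ¬ St a b
  steep-St {a} (inj₁ gap) st = contradiction (≤-trans gap (level-lipschitz st .proj₂)) (n+2≰1+n (level a))
  steep-St {b = b} (inj₂ gap) st = contradiction (≤-trans gap (level-lipschitz st .proj₁)) (n+2≰1+n (level b))

  steep-irrefl : ∀ a → ¬ Steep a a
  steep-irrefl a (inj₁ gap) = contradiction gap (m+1+n≰m (level a))
  steep-irrefl a (inj₂ gap) = contradiction gap (m+1+n≰m (level a))

  antipodal : ∀ j x → L j ≡ P + x → R ≤ x → x + R ≤ m → x < m → R ≤ pot P (c (L j))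
  antipodal j x e R≤x x≤ x<m = subst (λ t → R ≤ pot P (c t)) (sym e) (subst (R ≤_) (sym (pot-at P x<m))
      (tri-≥ R≤x x≤))

  level-high : ∀ {t} → R ≤ t → suc (suc (R + q)) ≤ suc (suc q + t)
  level-high {t} R≤t = (by {suc (suc (R + q))} {suc ((suc q) + t)} 0 R≤t (solve (R ∷ q ∷ t ∷ [])))

  -- As the feet are two apart, one of them is antipodal to `P`: P + R + 1 if `s` is even, P + R if
  -- it is odd. Its pendant has level d.
  opposite : ∃ λ j → j ≤ s × suc (suc (R + q)) ≤ level (pend j)
  opposite with parity s
  ... | j , inj₁ s≡ = j , (by {j} {s} j (≤-reflexive (sym s≡)) (solve (j ∷ s ∷ []))) , level-high
      (antipodal j (suc R) (≤-antisym (by {q + q + (j + j) + R + 4} {(suc (q + R)) + (suc R)} 0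
      (≤-reflexive (sym s≡) ⊹ R-≥) (solve (R ∷ j ∷ q ∷ s ∷ []))) (by {(suc (q + R)) + (suc R)}
      {q + q + (j + j) + R + 4} 0 (≤-reflexive s≡ ⊹ R-≤) (solve (R ∷ j ∷ q ∷ s ∷ []))))
        (n≤1+n R) (by {(suc R) + R} {m} 0 m-≥ (solve (R ∷ m ∷ []))) (by {suc (suc R)} {m} (q + s + 1)
            (R-≥ ⊹ m-≥) (solve (R ∷ m ∷ q ∷ s ∷ []))))
  ... | j , inj₂ s≡ = j , (by {j} {s} (j + 1) (≤-reflexive (sym s≡)) (solve (j ∷ s ∷ []))) , level-high
      (antipodal j R (≤-antisym (by {q + q + (j + j) + R + 4} {(suc (q + R)) + R} 0 (≤-reflexive (sym s≡) ⊹ R-≥)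
      (solve (R ∷ j ∷ q ∷ s ∷ []))) (by {(suc (q + R)) + R} {q + q + (j + j) + R + 4} 0 (≤-reflexive s≡ ⊹ R-≤)
      (solve (R ∷ j ∷ q ∷ s ∷ []))))
        ≤-refl (by {R + R} {m} 1 m-≥ (solve (R ∷ m ∷ []))) (by {suc R} {m} R m-≥ (solve (R ∷ m ∷ []))))

  gap-tri : ∀ a b {x y} → pot P a ≡ tri x → pot P b ≡ tri y → suc q + pot P a + 2 ≤ suc q + pot P b → tri x + 2
      ≤ tri y
  gap-tri a b e₁ e₂ gap = subst₂ (λ x y → x + 2 ≤ y) e₁ e₂ (+-cancelˡ-≤ (suc q) _ _ (subst (_≤ suc q + pot P b)
      (+-assoc (suc q) (pot P a) 2) gap))

  drop : ∀ {u v i j} → u + i ≡ q → v + j ≡ q → u + 2 ≤ v → j + 2 ≤ i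
  drop {u} {v} {i} {j} u+i≡ v+j≡ gap = (by {j + 2} {i} 0 (≤-reflexive (sym u+i≡) ⊹ ≤-reflexive v+j≡ ⊹ gap)
      (solve (i ∷ j ∷ q ∷ u ∷ v ∷ [])))

  -- For a leg the condition is only necessary: a leg near the foot of the path may still be within
  -- `R`.
  data Misses (τ : ℕ) : Vertex → Set where
    leg  : ∀ {i} → τ < q + q + 2 → Misses τ (leg i)
    apex : τ ≡ q + q + 2 → Misses τ apex
    pend : ∀ {j} → q + q + 3 + (j + j) ≤ τ → τ ≤ q + q + 4 + (j + j) → Misses τ (pend j)

  -- The path prolonged by its foot, so that walks along it need no special case at `P`.
  node : ℕ → Vertex
  node zero    = cyc (c P)
  node (suc i) = leg i

  node-OK : ∀ {i} → i ≤ suc q → OK (node i)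
  node-OK {zero}  _         = cyc (c<m P)
  node-OK {suc i} (s≤s i≤q) = leg i≤q

  node-St : ∀ i → St (node i) (node (suc i))
  node-St zero    = root refl
  node-St (suc i) = climb

  -- Walks in the base graph and its supergraphs

  module Walks {W : ℕ → Vertex → Vertex → Set} (reach : Reach OK St W) where
    open Reach reach

    ring-reach : Reach (_< m) Next (λ k a b → W k (cyc a) (cyc b))
    ring-reach = record
      { stay = stay ; _▷_ = _▷_ ; back = back ; weaken = weaken ; link = λ a b e → link (cyc a) (cyc b)
          (ring e) }

    open Walk ring-reach using (between; half)

    round : ∀ {a b} → a < m → b < m → W R (cyc a) (cyc b)
    round = half m-≤

    arc : ∀ {k} t u → t ≤ u + k → u ≤ t + k → W k (cyc (c t)) (cyc (c u))
    arc t u t≤u+k u≤t+k with ≤-total t u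
    ... | inj₁ t≤u = between t u t≤u u≤t+k
    ... | inj₂ u≤t = back (between u t u≤t t≤u+k)

    turn : ∀ {k t u w} → t ≡ u + m → W k (cyc (c t)) w → W k (cyc (c u)) w
    turn {k} {w = w} e = subst (λ b → W k (cyc b) w) (c-period e)

    node-up : ∀ d i → i + d ≤ suc q → W d (node i) (node (i + d))
    node-up zero    i _ = subst (W 0 (node i) ∘ node) (sym (+-identityʳ i)) stay
    node-up (suc d) i i+d<q = subst (W (suc d) (node i) ∘ node) (sym (+-suc i d))
      (link (node-OK (≤-trans (m≤m+n i (suc d)) i+d<q))
            (node-OK (≤-trans (s≤s (m≤m+n i d)) i+d≤q)) (node-St i)
       ▷ node-up d (suc i) i+d≤q)
      where
      i+d≤q : suc i + d ≤ suc q
      i+d≤q = subst (_≤ suc q) (+-suc i d) i+d<q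

    along : ∀ {k} i j → i ≤ suc q → j ≤ suc q → i ≤ j + k → j ≤ i + k → W k (node i) (node j)
    along i j i≤ j≤ i≤j+k j≤i+k with ≤-total i j
    ... | inj₁ i≤j with m≤n⇒∃[o]m+o≡n i≤j
    ...   | d , refl = weaken (+-cancelˡ-≤ i _ _ j≤i+k) (node-up d i j≤)
    along i j i≤ j≤ i≤j+k j≤i+k | inj₂ j≤i with m≤n⇒∃[o]m+o≡n j≤i
    ...   | d , refl = back (weaken (+-cancelˡ-≤ j _ _ i≤j+k) (node-up d j i≤))

    leg-walk : ∀ {i} → i ≤ q → W (suc i) (cyc (c P)) (leg i)
    leg-walk {i} i≤q = node-up (suc i) 0 (s≤s i≤q)

    apex-walk₁ : W 1 (cyc (c X)) apex
    apex-walk₁ = link (cyc (c<m X)) apex (apex₁ refl)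

    apex-walk₂ : W 1 (cyc (c (suc X))) apex
    apex-walk₂ = link (cyc (c<m (suc X))) apex (apex₂ refl)

    twig-walk : ∀ {j} → j ≤ s → W 1 (cyc (c (L j))) (pend j)
    twig-walk {j} j≤s = link (cyc (c<m (L j))) (pend j≤s) (twig refl)

    -- The disjunction excludes the two antipodes τ + R and τ + R + 1 of `τ`. Every other position
    -- is within R - 1, which leaves one step for an attachment.
    short : ∀ τ l → τ < m → R < l → l < m + R → suc l ≤ τ + R ⊎ τ + R + 2 ≤ l →
            W (suc (q + s)) (cyc (c τ)) (cyc (c l))
    short τ l τ<m R<l l<m+R (inj₁ before) = arc τ l
      (by {τ} {l + (suc (q + s))} 0 (τ<m ⊹ R<l ⊹ R-≤ ⊹ m-≤) (solve (R ∷ l ∷ m ∷ q ∷ s ∷ τ ∷ [])))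
          (by {l} {τ + (suc (q + s))} 0 (before ⊹ R-≤) (solve (R ∷ l ∷ q ∷ s ∷ τ ∷ [])))
    short τ l τ<m R<l l<m+R (inj₂ after) = turn refl (arc (τ + m) l
      (by {τ + m} {l + (suc (q + s))} 0 (after ⊹ R-≤ ⊹ m-≤) (solve (R ∷ l ∷ m ∷ q ∷ s ∷ τ ∷ [])))
          (by {l} {τ + m + (suc (q + s))} τ (l<m+R ⊹ R-≤) (solve (R ∷ l ∷ m ∷ q ∷ s ∷ τ ∷ []))))

    close : ∀ τ → τ < m → ∀ {w} → OK w → W R (cyc (c τ)) w ⊎ Misses τ w
    close τ τ<m (cyc b<m) = inj₁ (round (c<m τ) b<m)
    close τ τ<m (leg {i} i≤q) with ≤-<-connex (q + q + 2) τ
    ... | inj₂ τ<2p = inj₂ (leg τ<2p)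
    ... | inj₁ 2p≤τ = inj₁ (weaken (by {(suc s) + (suc i)} {R} 0 (i≤q ⊹ R-≥) (solve (R ∷ i ∷ q ∷ s ∷ [])))
      (arc τ P (by {τ} {(suc (q + R)) + (suc s)} 0 (τ<m ⊹ R-≤ ⊹ m-≤) (solve (R ∷ m ∷ q ∷ s ∷ τ ∷ [])))
          (by {suc (q + R)} {τ + (suc s)} 0 (2p≤τ ⊹ R-≤) (solve (R ∷ q ∷ s ∷ τ ∷ []))) ▷ leg-walk i≤q))
    close τ τ<m apex with <-cmp τ (q + q + 2)
    ... | tri≈ _ τ≡2p _ = inj₂ (apex τ≡2p)
    ... | tri< τ<2p _ _ = inj₁ (weaken (by {(suc (q + s)) + 1} {R} 0 R-≥ (solve (R ∷ q ∷ s ∷ [])))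
      (short τ (suc X) τ<m (slack {suc R} {suc (q + q + 2 + R)} (q + q + 2) (solve (R ∷ q ∷ [])))
          (by {suc (suc (q + q + 2 + R))} {m + R} (s + s + 1) (R-≥ ⊹ R-≥ ⊹ m-≥) (solve (R ∷ m ∷ q ∷ s ∷ [])))
        (inj₂ (by {τ + R + 2} {suc (q + q + 2 + R)} 0 τ<2p (solve (R ∷ q ∷ τ ∷ [])))) ▷ apex-walk₂))
    ... | tri> _ _ 2p<τ = inj₁ (weaken (by {(suc (q + s)) + 1} {R} 0 R-≥ (solve (R ∷ q ∷ s ∷ [])))
      (short τ X τ<m (slack {suc R} {q + q + 2 + R} (q + q + 1) (solve (R ∷ q ∷ []))) (by {suc (q + q + 2 + R)}
          {m + R} (s + s + 2) (R-≥ ⊹ R-≥ ⊹ m-≥) (solve (R ∷ m ∷ q ∷ s ∷ [])))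
        (inj₁ (by {suc (q + q + 2 + R)} {τ + R} 0 2p<τ (solve (R ∷ q ∷ τ ∷ [])))) ▷ apex-walk₁))
    close τ τ<m (pend {j} j≤s) with ≤-<-connex (q + q + 3 + (j + j)) τ
    ... | inj₂ after = inj₁ (weaken (by {(suc (q + s)) + 1} {R} 0 R-≥ (solve (R ∷ q ∷ s ∷ [])))
      (short τ (L j) τ<m (slack {suc R} {q + q + (j + j) + R + 4} (j + j + q + q + 3) (solve (R ∷ j ∷ q ∷ [])))
          (by {suc (q + q + (j + j) + R + 4)} {m + R} 0 (j≤s ⊹ j≤s ⊹ R-≥ ⊹ R-≥ ⊹ m-≥)
          (solve (R ∷ j ∷ m ∷ q ∷ s ∷ [])))
        (inj₂ (by {τ + R + 2} {q + q + (j + j) + R + 4} 0 after (solve (R ∷ j ∷ q ∷ τ ∷ [])))) ▷ twig-walk j≤s))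
    ... | inj₁ lower with ≤-<-connex τ (q + q + 4 + (j + j))
    ...   | inj₁ upper  = inj₂ (pend lower upper)
    ...   | inj₂ before = inj₁ (weaken (by {(suc (q + s)) + 1} {R} 0 R-≥ (solve (R ∷ q ∷ s ∷ [])))
      (short τ (L j) τ<m (slack {suc R} {q + q + (j + j) + R + 4} (j + j + q + q + 3) (solve (R ∷ j ∷ q ∷ [])))
          (by {suc (q + q + (j + j) + R + 4)} {m + R} 0 (j≤s ⊹ j≤s ⊹ R-≥ ⊹ R-≥ ⊹ m-≥)
          (solve (R ∷ j ∷ m ∷ q ∷ s ∷ [])))
        (inj₁ (by {suc (q + q + (j + j) + R + 4)} {τ + R} 0 before (solve (R ∷ j ∷ q ∷ τ ∷ []))))
            ▷ twig-walk j≤s))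

    -- Shortened routes that create a centre

    Centre : Set
    Centre = ∃ λ τ → ∀ {w} → OK w → W R (cyc (c τ)) w

    -- By `close`, such a `τ` misses nothing outside the path. `apex-centre` and `pend-centre` work
    -- alike.
    leg-centre : ∀ τ → τ < q + q + 2 → (∀ {i} → i ≤ q → W R (cyc (c τ)) (leg i)) → Centre
    leg-centre τ τ<2p reaches = τ , all
      where
      all : ∀ {w} → OK w → W R (cyc (c τ)) w
      all ok with close τ (by {suc τ} {m} (s + s + 3) (τ<2p ⊹ R-≥ ⊹ R-≥ ⊹ m-≥)
          (solve (R ∷ m ∷ q ∷ s ∷ τ ∷ []))) ok
      all _         | inj₁ p = p
      all (leg i≤q) | inj₂ (leg _) = reaches i≤q
      all apex      | inj₂ (apex τ≡2p) = contradiction (sym τ≡2p) (>⇒≢ τ<2p)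
      all (pend {j} _) | inj₂ (pend lower _) =
        contradiction (by {q + q + 2} {τ} (j + j + 1) lower (solve (j ∷ q ∷ τ ∷ []))) (<⇒≱ τ<2p)

    apex-centre : W R (cyc (c (q + q + 2))) apex → Centre
    apex-centre reaches = q + q + 2 , all
      where
      all : ∀ {w} → OK w → W R (cyc (c (q + q + 2))) w
      all ok with close (q + q + 2) (by {suc (q + q + 2)} {m} (s + s + 2) (R-≥ ⊹ R-≥ ⊹ m-≥)
          (solve (R ∷ m ∷ q ∷ s ∷ []))) ok
      all _    | inj₁ p = p
      all apex | inj₂ _ = reaches
      all _    | inj₂ (leg 2p<2p) = contradiction 2p<2p (<-irrefl refl)
      all _    | inj₂ (pend {j} lower _) =
        contradiction (by {suc (q + q + 2)} {q + q + 2} (j + j) lower (solve (j ∷ q ∷ []))) 1+n≰n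

    pend-centre : ∀ {j} τ → j ≤ s → q + q + 3 + (j + j) ≤ τ → τ ≤ q + q + 4 + (j + j) →
                  W R (cyc (c τ)) (pend j) → Centre
    pend-centre {j} τ j≤s lower upper reaches = τ , all
      where
      all : ∀ {w} → OK w → W R (cyc (c τ)) w
      all ok with close τ (by {suc τ} {m} 0 (upper ⊹ j≤s ⊹ j≤s ⊹ R-≥ ⊹ R-≥ ⊹ m-≥)
          (solve (R ∷ j ∷ m ∷ q ∷ s ∷ τ ∷ []))) ok
      all _ | inj₁ p = p
      all _ | inj₂ (leg τ<2p) =
        contradiction (by {q + q + 2} {τ} (j + j + 1) lower (solve (j ∷ q ∷ τ ∷ []))) (<⇒≱ τ<2p)
      all _ | inj₂ (apex refl) =
        contradiction (by {suc (q + q + 2)} {q + q + 2} (j + j) lower (solve (j ∷ q ∷ []))) 1+n≰n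
      all _ | inj₂ (pend {i} lower′ upper′) with <-cmp i j
      ... | tri≈ _ refl _ = reaches
      ... | tri< i<j _ _ = contradiction (by {suc τ} {τ} 0 (lower ⊹ upper′ ⊹ i<j ⊹ i<j)
          (solve (i ∷ j ∷ q ∷ τ ∷ []))) 1+n≰n
      ... | tri> _ _ j<i = contradiction (by {suc τ} {τ} 0 (lower′ ⊹ upper ⊹ j<i ⊹ j<i)
          (solve (i ∷ j ∷ q ∷ τ ∷ []))) 1+n≰n

    -- By way of `P` all legs except the last are within s + 2 + q = R.
    tip-centre : ∀ τ → τ < q + q + 2 → W (s + 2) (cyc (c τ)) (cyc (c P)) → W R (cyc (c τ)) (leg q) → Centre
    tip-centre τ τ<2p to-P reaches = leg-centre τ τ<2p λ {i} i≤q → all i≤q (m≤n⇒m<n∨m≡n i≤q)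
      where
      all : ∀ {i} → i ≤ q → i < q ⊎ i ≡ q → W R (cyc (c τ)) (leg i)
      all {i} i≤q (inj₁ i<q) = weaken (by {s + 2 + (suc i)} {R} 0 (i<q ⊹ R-≥) (solve (R ∷ i ∷ q ∷ s ∷ [])))
          (to-P ▷ leg-walk i≤q)
      all _   (inj₂ refl) = reaches

    -- The centre is position 0, which lies s + 2 after `P`. Its route through `P` to the end of the
    -- path has length R + 1; the given walk replaces a piece of length x + i and so saves a step.
    leg-shortcut-near : ∀ {k} x i → i ≤ suc q → x ≤ s + 2 → suc k ≤ x + i →
                        W k (cyc (c (P + x))) (node i) → Centre
    leg-shortcut-near {k} x i i≤ x≤ k<x+i w with m≤n⇒∃[o]m+o≡n x≤ | m≤n⇒∃[o]m+o≡n i≤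
    ... | x′ , x+x′≡ | i′ , i+i′≡ = tip-centre 0 (slack {suc 0} {q + q + 2} (q + q + 1) (solve (q ∷ [])))
      (turn refl (arc m P (by {m} {(suc (q + R)) + (s + 2)} 0 (R-≤ ⊹ m-≤) (solve (R ∷ m ∷ q ∷ s ∷ [])))
          (by {suc (q + R)} {m + (s + 2)} (s + s + 4) (R-≥ ⊹ m-≥) (solve (R ∷ m ∷ q ∷ s ∷ [])))))
      (weaken (by {x′ + (k + i′)} {R} 0 (≤-reflexive x+x′≡ ⊹ ≤-reflexive i+i′≡ ⊹ k<x+i ⊹ R-≥)
          (solve (R ∷ i ∷ i′ ∷ k ∷ q ∷ s ∷ x ∷ x′ ∷ [])))
        (turn refl (arc m (P + x) (by {m} {(suc (q + R)) + x + x′} 0 (≤-reflexive (sym x+x′≡) ⊹ R-≤ ⊹ m-≤)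
            (solve (R ∷ m ∷ q ∷ s ∷ x ∷ x′ ∷ []))) (by {(suc (q + R)) + x} {m + x′} x′ (x≤ ⊹ R-≥ ⊹ m-≥)
            (solve (R ∷ m ∷ q ∷ s ∷ x ∷ x′ ∷ []))))
          ▷ w ▷ along i (suc q) i≤ ≤-refl (by {i} {(suc q) + i′} i′ i≤ (solve (i ∷ i′ ∷ q ∷ [])))
              (≤-reflexive (sym i+i′≡))))

    -- The bounds on x + i and x + k say that the walk is shorter than each of the two routes through P.
    leg-shortcut : ∀ {k} x i → x < m → i ≤ suc q → suc k ≤ x + i → suc (x + k) ≤ m + i → k ≤ 2 → k ≤ suc i →
                   W k (cyc (c (P + x))) (node i) → Centre
    leg-shortcut {k} x i x<m i≤ k<x+i x+k<m+i k≤2 k≤si w with ≤-<-connex x (s + 2)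
    ... | inj₁ x≤ = leg-shortcut-near x i i≤ x≤ k<x+i w
    ... | inj₂ s+2<x with ≤-<-connex m (x + (s + 2)) | m≤n⇒∃[o]m+o≡n (<⇒≤ s+2<x) | m≤n⇒∃[o]m+o≡n i≤
    ...   | inj₁ m≤ | _ | i′ , i+i′≡ with m≤n⇒∃[o]m+o≡n m≤
    -- The mirror image: the centre 2p - 1 lies s + 2 before `P`.
    ...     | x′ , m+x′≡ = tip-centre (q + q + 1) (slack {suc (q + q + 1)} {q + q + 2} 0 (solve (q ∷ [])))
      (arc (q + q + 1) P (by {q + q + 1} {(suc (q + R)) + (s + 2)} (s + s + 4) R-≥ (solve (R ∷ q ∷ s ∷ [])))
          (by {suc (q + R)} {q + q + 1 + (s + 2)} 0 R-≤ (solve (R ∷ q ∷ s ∷ []))))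
      (weaken (by {x′ + (k + i′)} {R} 0 (≤-reflexive m+x′≡ ⊹ ≤-reflexive i+i′≡ ⊹ x+k<m+i ⊹ R-≥)
          (solve (R ∷ i ∷ i′ ∷ k ∷ m ∷ q ∷ s ∷ x ∷ x′ ∷ [])))
        (turn refl (arc (q + q + 1 + m) (P + x) (by {q + q + 1 + m} {(suc (q + R)) + x + x′} x′ (m≤ ⊹ R-≥)
            (solve (R ∷ m ∷ q ∷ s ∷ x ∷ x′ ∷ [])))
                    (by {(suc (q + R)) + x} {q + q + 1 + m + x′} 0 (≤-reflexive (sym m+x′≡) ⊹ R-≤)
                        (solve (R ∷ m ∷ q ∷ s ∷ x ∷ x′ ∷ []))))
          ▷ w ▷ along i (suc q) i≤ ≤-refl (by {i} {(suc q) + i′} i′ i≤ (solve (i ∷ i′ ∷ q ∷ [])))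
              (≤-reflexive (sym i+i′≡))))
    -- Here P + x is, modulo `m`, itself a position `τ` below 2p. It is the centre: all legs are
    -- within q + 2 of it by way of `node i`.
    leg-shortcut {k} x i x<m i≤ k<x+i x+k<m+i k≤2 k≤si w | inj₂ s+2<x | inj₂ x<m-s | τ , refl | _ =
      mid (m≤n⇒∃[o]m+o≡n {k} {R} (by {k} {R} (q + s) (k≤2 ⊹ R-≥) (solve (R ∷ k ∷ q ∷ s ∷ []))))
      where
      mid : (∃ λ k′ → k + k′ ≡ R) → Centre
      mid (k′ , k+k′≡) = leg-centre τ (by {suc τ} {q + q + 2} 1 (x<m-s ⊹ R-≤ ⊹ R-≤ ⊹ m-≤)
          (solve (R ∷ m ∷ q ∷ s ∷ τ ∷ [])))
        λ {h} h≤q → weaken (≤-reflexive k+k′≡)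
          (turn (≤-antisym (by {(suc (q + R)) + (s + 2 + τ)} {τ + m} 0 (R-≥ ⊹ m-≥)
              (solve (R ∷ m ∷ q ∷ s ∷ τ ∷ []))) (by {τ + m} {(suc (q + R)) + (s + 2 + τ)} 0 (R-≤ ⊹ m-≤)
              (solve (R ∷ m ∷ q ∷ s ∷ τ ∷ [])))) w
            ▷ along i (suc h) i≤ (s≤s h≤q)
                (by {i} {(suc h) + k′} (h + s) (i≤ ⊹ k≤2 ⊹ ≤-reflexive (sym k+k′≡) ⊹ R-≥)
                    (solve (R ∷ h ∷ i ∷ k ∷ k′ ∷ q ∷ s ∷ [])))
                (by {suc h} {i + k′} s (h≤q ⊹ k≤si ⊹ ≤-reflexive (sym k+k′≡) ⊹ R-≥)
                    (solve (R ∷ h ∷ i ∷ k ∷ k′ ∷ q ∷ s ∷ []))))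

    -- The walk is no longer than the arc from its start to `L j`, so it saves the final step to the
    -- pendant. The centre is the antipode of `L j` whose arc of length `R` to `L j` passes through
    -- L j + x.
    pend-shortcut : ∀ {k} j x → j ≤ s → k ≤ x → x + k ≤ m → W k (cyc (c (L j + x))) (pend j) → Centre
    pend-shortcut {k} j x j≤s k≤x x+k≤m w with ≤-<-connex x R
    ... | inj₁ x≤R with m≤n⇒∃[o]m+o≡n x≤R
    ...   | x′ , x+x′≡ = pend-centre (q + q + 3 + (j + j)) j≤s ≤-refl (slack {q + q + 3 + (j + j)}
        {q + q + 4 + (j + j)} 1 (solve (j ∷ q ∷ [])))
      (weaken (by {x′ + k} {R} 0 (≤-reflexive x+x′≡ ⊹ k≤x) (solve (R ∷ k ∷ x ∷ x′ ∷ [])))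
        (turn (≤-antisym (by {(q + q + (j + j) + R + 4) + R} {q + q + 3 + (j + j) + m} 0 m-≥
            (solve (R ∷ j ∷ m ∷ q ∷ []))) (by {q + q + 3 + (j + j) + m} {(q + q + (j + j) + R + 4) + R} 0 m-≤
            (solve (R ∷ j ∷ m ∷ q ∷ []))))
          (arc (L j + R) (L j + x) (by {(q + q + (j + j) + R + 4) + R} {(q + q + (j + j) + R + 4) + x + x′} 0
              (≤-reflexive (sym x+x′≡)) (solve (R ∷ j ∷ q ∷ x ∷ x′ ∷ []))) (by {(q + q + (j + j) + R + 4) + x}
              {(q + q + (j + j) + R + 4) + R + x′} x′ x≤R (solve (R ∷ j ∷ q ∷ x ∷ x′ ∷ [])))) ▷ w))
    pend-shortcut {k} j x j≤s k≤x x+k≤m w | inj₂ R<x with m≤n⇒∃[o]m+o≡n R<x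
    ...   | x′ , sR+x′≡ = pend-centre (q + q + 4 + (j + j)) j≤s (slack {q + q + 3 + (j + j)}
        {q + q + 4 + (j + j)} 1 (solve (j ∷ q ∷ []))) ≤-refl
      (weaken (by {x′ + k} {R} 0 (≤-reflexive sR+x′≡ ⊹ x+k≤m ⊹ m-≤) (solve (R ∷ k ∷ m ∷ x ∷ x′ ∷ [])))
        (turn (≤-antisym (by {(q + q + (j + j) + R + 4) + (suc R)} {q + q + 4 + (j + j) + m} 0 m-≥
            (solve (R ∷ j ∷ m ∷ q ∷ []))) (by {q + q + 4 + (j + j) + m} {(q + q + (j + j) + R + 4) +
            (suc R)} 0 m-≤ (solve (R ∷ j ∷ m ∷ q ∷ []))))
          (arc (L j + suc R) (L j + x) (by {(q + q + (j + j) + R + 4) + (suc R)}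
              {(q + q + (j + j) + R + 4) + x + x′} x′ R<x (solve (R ∷ j ∷ q ∷ x ∷ x′ ∷ [])))
            (by {(q + q + (j + j) + R + 4) + x} {(q + q + (j + j) + R + 4) + (suc R) + x′} 0
                (≤-reflexive (sym sR+x′≡)) (solve (R ∷ j ∷ q ∷ x ∷ x′ ∷ [])))) ▷ w))

    -- Position 2p is at distance `R` from `X` and X + 1 only; any other cycle position is within R
    -- - 1 of it.
    apex-shortcut : ∀ x → x < m → 2 ≤ x → W 1 (cyc (c (X + x))) apex → Centre
    apex-shortcut x x<m 2≤x w with ≤-<-connex x (suc R)
    ... | inj₁ x≤ with m≤n⇒∃[o]m+o≡n x≤
    ...   | x′ , x+x′≡ = apex-centre (weaken (by {x′ + 1} {R} 0 (≤-reflexive x+x′≡ ⊹ 2≤x)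
        (solve (R ∷ x ∷ x′ ∷ [])))
      (turn (≤-antisym (by {(q + q + 2 + R) + (suc R)} {q + q + 2 + m} 0 m-≥ (solve (R ∷ m ∷ q ∷ [])))
          (by {q + q + 2 + m} {(q + q + 2 + R) + (suc R)} 0 m-≤ (solve (R ∷ m ∷ q ∷ []))))
        (arc (X + suc R) (X + x) (by {(q + q + 2 + R) + (suc R)} {(q + q + 2 + R) + x + x′} 0
            (≤-reflexive (sym x+x′≡)) (solve (R ∷ q ∷ x ∷ x′ ∷ [])))
          (by {(q + q + 2 + R) + x} {(q + q + 2 + R) + (suc R) + x′} x′ x≤ (solve (R ∷ q ∷ x ∷ x′ ∷ [])))) ▷ w))
    apex-shortcut x x<m 2≤x w | inj₂ sR<x with m≤n⇒∃[o]m+o≡n sR<x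
    ...   | x′ , ssR+x′≡ = apex-centre (weaken (by {(suc x′) + 1} {R} 0 (≤-reflexive ssR+x′≡ ⊹ x<m ⊹ m-≤)
        (solve (R ∷ m ∷ x ∷ x′ ∷ [])))
      (turn (≤-antisym (by {(q + q + 2 + R) + (suc R)} {q + q + 2 + m} 0 m-≥ (solve (R ∷ m ∷ q ∷ [])))
          (by {q + q + 2 + m} {(q + q + 2 + R) + (suc R)} 0 m-≤ (solve (R ∷ m ∷ q ∷ []))))
        (arc (X + suc R) (X + x) (by {(q + q + 2 + R) + (suc R)} {(q + q + 2 + R) + x + (suc x′)} (x′ + 2) sR<x
            (solve (R ∷ q ∷ x ∷ x′ ∷ [])))
          (by {(q + q + 2 + R) + x} {(q + q + 2 + R) + (suc R) + (suc x′)} 0 (≤-reflexive (sym ssR+x′≡))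
              (solve (R ∷ q ∷ x ∷ x′ ∷ [])))) ▷ w))

    -- New edges at an attachment

    leg-leg : ∀ {i j} → j ≤ q → i + 2 ≤ j → W 1 (leg i) (leg j) → Centre
    leg-leg {i} {j} j≤q i+2≤j w = leg-shortcut-near 0 (suc j) (s≤s j≤q) z≤n (by {suc ((suc i) + 1)}
        {0 + (suc j)} 0 i+2≤j (solve (i ∷ j ∷ [])))
      (subst (λ t → W (suc i + 1) (cyc (c t)) (leg j)) (sym (+-identityʳ P))
        (leg-walk (by {i} {q} 2 (i+2≤j ⊹ j≤q) (solve (i ∷ j ∷ q ∷ []))) ▷ w))

    leg-cyc : ∀ {i x} → i ≤ q → x < m → 1 ≤ x + i → W 1 (cyc (c (P + x))) (leg i) → Centre
    leg-cyc {i} {x} i≤q x<m 1≤x+i = leg-shortcut x (suc i) x<m (s≤s i≤q)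
      (by {2} {x + (suc i)} 0 1≤x+i (solve (i ∷ x ∷ []))) (by {suc (x + 1)} {m + (suc i)} i x<m
          (solve (i ∷ m ∷ x ∷ []))) (s≤s z≤n) (s≤s z≤n)

    leg-apex : ∀ {i} → i ≤ q → W 1 apex (leg i) → Centre
    -- The offset of X + 1 from `P`. From `X`, at offset q + 1, the walk would be no shorter than
    -- the route through `P` when `q` and `i` are 0.
    leg-apex {i} i≤q w = leg-shortcut (q + 2) (suc i) (by {suc (q + 2)} {m} (R + s) (R-≥ ⊹ m-≥)
        (solve (R ∷ m ∷ q ∷ s ∷ []))) (s≤s i≤q)
      (slack {3} {q + 2 + (suc i)} (i + q) (solve (i ∷ q ∷ []))) (by {suc (q + 2 + 2)} {m + (suc i)}
          (i + q + s + s + 1) (R-≥ ⊹ R-≥ ⊹ m-≥) (solve (R ∷ i ∷ m ∷ q ∷ s ∷ []))) (s≤s (s≤s z≤n))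
          (s≤s (s≤s z≤n))
      (subst (λ t → W 2 (cyc (c t)) (leg i)) (≤-antisym (slack {suc (q + q + 2 + R)} {(suc (q + R)) + (q + 2)} 0
          (solve (R ∷ q ∷ []))) (slack {(suc (q + R)) + (q + 2)} {suc (q + q + 2 + R)} 0 (solve (R ∷ q ∷ []))))
          (apex-walk₂ ▷ w))

    leg-pend : ∀ {i j} → i ≤ q → j ≤ s → W 1 (pend j) (leg i) → Centre
    leg-pend {i} {j} i≤q j≤s w = leg-shortcut (q + 3 + (j + j)) (suc i) (by {suc (q + 3 + (j + j))} {m} (q + 1)
        (j≤s ⊹ j≤s ⊹ R-≥ ⊹ R-≥ ⊹ m-≥) (solve (R ∷ j ∷ m ∷ q ∷ s ∷ []))) (s≤s i≤q)
      (slack {3} {q + 3 + (j + j) + (suc i)} (i + j + j + q + 1) (solve (i ∷ j ∷ q ∷ [])))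
          (by {suc (q + 3 + (j + j) + 2)} {m + (suc i)} (i + q) (j≤s ⊹ j≤s ⊹ R-≥ ⊹ R-≥ ⊹ m-≥)
          (solve (R ∷ i ∷ j ∷ m ∷ q ∷ s ∷ []))) (s≤s (s≤s z≤n)) (s≤s (s≤s z≤n))
      (subst (λ t → W 2 (cyc (c t)) (leg i)) (≤-antisym (slack {q + q + (j + j) + R + 4}
          {(suc (q + R)) + (q + 3 + (j + j))} 0 (solve (R ∷ j ∷ q ∷ [])))
          (slack {(suc (q + R)) + (q + 3 + (j + j))} {q + q + (j + j) + R + 4} 0 (solve (R ∷ j ∷ q ∷ []))))
          (twig-walk j≤s ▷ w))

    pend-pend : ∀ {j k} → k ≤ s → j < k → W 1 (pend k) (pend j) → Centre
    pend-pend {j} {k} k≤s j<k w with m≤n⇒∃[o]m+o≡n j<k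
    -- The offset between the two feet; their spacing makes it at least 2, the length of the walk.
    ... | d , refl = pend-shortcut j (d + d + 2) (by {j} {s} (d + 1) k≤s (solve (d ∷ j ∷ s ∷ [])))
        (slack {2} {d + d + 2} (d + d) (solve (d ∷ [])))
      (by {d + d + 2 + 2} {m} (j + j + q + q + 3) (k≤s ⊹ k≤s ⊹ R-≥ ⊹ R-≥ ⊹ m-≥)
          (solve (R ∷ d ∷ j ∷ m ∷ q ∷ s ∷ [])))
      (subst (λ t → W 2 (cyc (c t)) (pend j))
          (≤-antisym (slack {q + q + ((suc (j + d)) + (suc (j + d))) + R + 4} {(q + q + (j + j) + R + 4) +
          (d + d + 2)} 0 (solve (R ∷ d ∷ j ∷ q ∷ []))) (slack {(q + q + (j + j) + R + 4) + (d + d + 2)}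
          {q + q + ((suc (j + d)) + (suc (j + d))) + R + 4} 0 (solve (R ∷ d ∷ j ∷ q ∷ []))))
          (twig-walk k≤s ▷ w))

    pend-apex : ∀ {j} → j ≤ s → W 1 apex (pend j) → Centre
    pend-apex {j} j≤s w with m≤n⇒∃[o]m+o≡n j≤s
    -- The offset from `L j` forward to `X`. The other foot X + 1 is only one step from `L 0`, so a
    -- walk of length 2 from there would save nothing for `j` = 0.
    ... | d , j+d≡ = pend-shortcut j (q + q + 3 + (d + d)) j≤s (slack {2} {q + q + 3 + (d + d)}
        (d + d + q + q + 1) (solve (d ∷ q ∷ [])))
      (by {q + q + 3 + (d + d) + 2} {m} (j + j) (≤-reflexive j+d≡ ⊹ ≤-reflexive j+d≡ ⊹ R-≥ ⊹ R-≥ ⊹ m-≥)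
          (solve (R ∷ d ∷ j ∷ m ∷ q ∷ s ∷ [])))
      (subst (λ b → W 2 (cyc b) (pend j))
          (sym (c-period (≤-antisym (by {(q + q + (j + j) + R + 4) + (q + q + 3 + (d + d))}
          {(q + q + 2 + R) + m} 0 (≤-reflexive j+d≡ ⊹ ≤-reflexive j+d≡ ⊹ R-≥ ⊹ R-≥ ⊹ m-≥)
          (solve (R ∷ d ∷ j ∷ m ∷ q ∷ s ∷ []))) (by {(q + q + 2 + R) + m} {(q + q + (j + j) + R + 4) +
          (q + q + 3 + (d + d))} 0 (≤-reflexive (sym j+d≡) ⊹ ≤-reflexive (sym j+d≡) ⊹ R-≤ ⊹ R-≤ ⊹ m-≤)
          (solve (R ∷ d ∷ j ∷ m ∷ q ∷ s ∷ []))))))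
        (apex-walk₁ ▷ w))

    -- Chords of the cycle

    via-pend : ∀ {y z} τ j k₁ k₂ → j ≤ s → q + q + 3 + (j + j) ≤ τ → τ ≤ q + q + 4 + (j + j) →
               k₁ + suc (k₂ + 1) ≤ R → W k₁ (cyc (c τ)) y → W 1 y z → W k₂ z (cyc (c (L j))) → Centre
    via-pend τ j k₁ k₂ j≤s lower upper k≤R τy yz zL =
      pend-centre τ j≤s lower upper (weaken k≤R (τy ▷ yz ▷ zL ▷ twig-walk j≤s))

    Chord : ℕ → ℕ → Set
    Chord x₁ x₂ = W 1 (cyc (c (P + x₁))) (cyc (c (P + x₂))) → Centre

    -- In the four chord lemmas, suc b and a are the distances of the endpoints from P, and a′ completes a to R.  The
    -- pendant used is the one opposite to P, or a neighbour of it; which one depends on the parity of s.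
    chord-rr : ∀ {b a a′} → suc b + 2 ≤ a → a + a′ ≡ R → Chord (suc b) a
    chord-rr {b} {a} {a′} b<a a+a′≡ w with parity s
    ... | i , inj₁ s≡ = via-pend (P + 1) i b (suc a′) (by {i} {s} i (≤-reflexive (sym s≡)) (solve (i ∷ s ∷ [])))
      (by {q + q + 3 + (i + i)} {(suc (q + R)) + 1} 1 (≤-reflexive (sym s≡) ⊹ R-≥) (solve (R ∷ i ∷ q ∷ s ∷ [])))
          (by {(suc (q + R)) + 1} {q + q + 4 + (i + i)} 0 (≤-reflexive s≡ ⊹ R-≤) (solve (R ∷ i ∷ q ∷ s ∷ [])))
      (by {b + (suc ((suc a′) + 1))} {R} 0 (b<a ⊹ ≤-reflexive a+a′≡) (solve (R ∷ a ∷ a′ ∷ b ∷ [])))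
      (arc (P + 1) (P + suc b) (slack {(suc (q + R)) + 1} {(suc (q + R)) + (suc b) + b} (b + b)
          (solve (R ∷ b ∷ q ∷ []))) (slack {(suc (q + R)) + (suc b)} {(suc (q + R)) + 1 + b} 0
          (solve (R ∷ b ∷ q ∷ [])))) w
      (arc (P + a) (L i) (by {(suc (q + R)) + a} {(q + q + (i + i) + R + 4) + (suc a′)} (a′ + a′ + 2)
          (≤-reflexive s≡ ⊹ ≤-reflexive a+a′≡ ⊹ R-≤) (solve (R ∷ a ∷ a′ ∷ i ∷ q ∷ s ∷ [])))
                         (by {q + q + (i + i) + R + 4} {(suc (q + R)) + a + (suc a′)} 0 (≤-reflexive (sym s≡) ⊹
                             ≤-reflexive (sym a+a′≡) ⊹ R-≥) (solve (R ∷ a ∷ a′ ∷ i ∷ q ∷ s ∷ []))))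
    ... | i , inj₂ s≡ = via-pend P i (suc b) a′ (by {i} {s} (i + 1) (≤-reflexive (sym s≡)) (solve (i ∷ s ∷ [])))
      (by {q + q + 3 + (i + i)} {suc (q + R)} 1 (≤-reflexive (sym s≡) ⊹ R-≥) (solve (R ∷ i ∷ q ∷ s ∷ [])))
          (by {suc (q + R)} {q + q + 4 + (i + i)} 0 (≤-reflexive s≡ ⊹ R-≤) (solve (R ∷ i ∷ q ∷ s ∷ [])))
      (by {(suc b) + (suc (a′ + 1))} {R} 0 (b<a ⊹ ≤-reflexive a+a′≡) (solve (R ∷ a ∷ a′ ∷ b ∷ [])))
      (arc P (P + suc b) (slack {suc (q + R)} {(suc (q + R)) + (suc b) + (suc b)} (b + b + 2)
          (solve (R ∷ b ∷ q ∷ []))) (slack {(suc (q + R)) + (suc b)} {(suc (q + R)) + (suc b)} 0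
          (solve (R ∷ b ∷ q ∷ [])))) w
      (arc (P + a) (L i) (by {(suc (q + R)) + a} {(q + q + (i + i) + R + 4) + a′} (a′ + a′)
          (≤-reflexive s≡ ⊹ ≤-reflexive a+a′≡ ⊹ R-≤) (solve (R ∷ a ∷ a′ ∷ i ∷ q ∷ s ∷ [])))
                         (by {q + q + (i + i) + R + 4} {(suc (q + R)) + a + a′} 0 (≤-reflexive (sym s≡) ⊹
                             ≤-reflexive (sym a+a′≡) ⊹ R-≥) (solve (R ∷ a ∷ a′ ∷ i ∷ q ∷ s ∷ []))))

    chord-ll : ∀ {x₁ x₂ b a a′} → x₁ + suc b ≡ m → x₂ + a ≡ m → suc b + 2 ≤ a → a + a′ ≡ R → Chord x₁ x₂
    chord-ll {x₁} {x₂} {b} {a} {a′} x₁≡ x₂≡ b<a a+a′≡ w with parity s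
    ... | i , inj₁ s≡ = via-pend P i (suc b) a′ (by {i} {s} i (≤-reflexive (sym s≡)) (solve (i ∷ s ∷ [])))
      (by {q + q + 3 + (i + i)} {suc (q + R)} 0 (≤-reflexive (sym s≡) ⊹ R-≥) (solve (R ∷ i ∷ q ∷ s ∷ [])))
          (by {suc (q + R)} {q + q + 4 + (i + i)} 1 (≤-reflexive s≡ ⊹ R-≤) (solve (R ∷ i ∷ q ∷ s ∷ [])))
      (by {(suc b) + (suc (a′ + 1))} {R} 0 (b<a ⊹ ≤-reflexive a+a′≡) (solve (R ∷ a ∷ a′ ∷ b ∷ [])))
      (turn refl (arc (P + m) (P + x₁) (by {(suc (q + R)) + m} {(suc (q + R)) + x₁ + (suc b)} 0
          (≤-reflexive (sym x₁≡)) (solve (R ∷ b ∷ m ∷ q ∷ x₁ ∷ [])))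
                                       (by {(suc (q + R)) + x₁} {(suc (q + R)) + m + (suc b)} (b + b + 2)
                                           (≤-reflexive x₁≡) (solve (R ∷ b ∷ m ∷ q ∷ x₁ ∷ []))))) w
      (arc (P + x₂) (L i) (by {(suc (q + R)) + x₂} {(q + q + (i + i) + R + 4) + a′} 0
          (≤-reflexive s≡ ⊹ ≤-reflexive x₂≡ ⊹ ≤-reflexive (sym a+a′≡) ⊹ R-≤ ⊹ m-≤)
          (solve (R ∷ a ∷ a′ ∷ i ∷ m ∷ q ∷ s ∷ x₂ ∷ [])))
                          (by {q + q + (i + i) + R + 4} {(suc (q + R)) + x₂ + a′} (a′ + a′)
                              (≤-reflexive (sym s≡) ⊹ ≤-reflexive (sym x₂≡) ⊹ ≤-reflexive a+a′≡ ⊹ R-≥ ⊹ m-≥)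
                              (solve (R ∷ a ∷ a′ ∷ i ∷ m ∷ q ∷ s ∷ x₂ ∷ []))))
    ... | i , inj₂ s≡ = via-pend (q + R) i b (suc a′) (by {i} {s} (i + 1) (≤-reflexive (sym s≡))
        (solve (i ∷ s ∷ [])))
      (by {q + q + 3 + (i + i)} {q + R} 0 (≤-reflexive (sym s≡) ⊹ R-≥) (solve (R ∷ i ∷ q ∷ s ∷ [])))
          (by {q + R} {q + q + 4 + (i + i)} 1 (≤-reflexive s≡ ⊹ R-≤) (solve (R ∷ i ∷ q ∷ s ∷ [])))
      (by {b + (suc ((suc a′) + 1))} {R} 0 (b<a ⊹ ≤-reflexive a+a′≡) (solve (R ∷ a ∷ a′ ∷ b ∷ [])))
      (turn refl (arc (q + R + m) (P + x₁) (by {q + R + m} {(suc (q + R)) + x₁ + b} 0 (≤-reflexive (sym x₁≡))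
          (solve (R ∷ b ∷ m ∷ q ∷ x₁ ∷ [])))
                                           (by {(suc (q + R)) + x₁} {q + R + m + b} (b + b) (≤-reflexive x₁≡)
                                               (solve (R ∷ b ∷ m ∷ q ∷ x₁ ∷ []))))) w
      (arc (P + x₂) (L i) (by {(suc (q + R)) + x₂} {(q + q + (i + i) + R + 4) + (suc a′)} 0
          (≤-reflexive s≡ ⊹ ≤-reflexive x₂≡ ⊹ ≤-reflexive (sym a+a′≡) ⊹ R-≤ ⊹ m-≤)
          (solve (R ∷ a ∷ a′ ∷ i ∷ m ∷ q ∷ s ∷ x₂ ∷ [])))
                          (by {q + q + (i + i) + R + 4} {(suc (q + R)) + x₂ + (suc a′)} (a′ + a′ + 2)
                              (≤-reflexive (sym s≡) ⊹ ≤-reflexive (sym x₂≡) ⊹ ≤-reflexive a+a′≡ ⊹ R-≥ ⊹ m-≥)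
                              (solve (R ∷ a ∷ a′ ∷ i ∷ m ∷ q ∷ s ∷ x₂ ∷ []))))

    chord-lr : ∀ {x₁ b a a′} → x₁ + suc b ≡ m → suc b + 2 ≤ a → a + a′ ≡ R → Chord x₁ a
    chord-lr {x₁} {b} {a} {a′} x₁≡ b<a a+a′≡ w with parity s
    ... | i , inj₂ s≡ = via-pend P i (suc b) a′ (by {i} {s} (i + 1) (≤-reflexive (sym s≡)) (solve (i ∷ s ∷ [])))
      (by {q + q + 3 + (i + i)} {suc (q + R)} 1 (≤-reflexive (sym s≡) ⊹ R-≥) (solve (R ∷ i ∷ q ∷ s ∷ [])))
          (by {suc (q + R)} {q + q + 4 + (i + i)} 0 (≤-reflexive s≡ ⊹ R-≤) (solve (R ∷ i ∷ q ∷ s ∷ [])))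
      (by {(suc b) + (suc (a′ + 1))} {R} 0 (b<a ⊹ ≤-reflexive a+a′≡) (solve (R ∷ a ∷ a′ ∷ b ∷ [])))
      (turn refl (arc (P + m) (P + x₁) (by {(suc (q + R)) + m} {(suc (q + R)) + x₁ + (suc b)} 0
          (≤-reflexive (sym x₁≡)) (solve (R ∷ b ∷ m ∷ q ∷ x₁ ∷ [])))
                                       (by {(suc (q + R)) + x₁} {(suc (q + R)) + m + (suc b)} (b + b + 2)
                                           (≤-reflexive x₁≡) (solve (R ∷ b ∷ m ∷ q ∷ x₁ ∷ []))))) w
      (arc (P + a) (L i) (by {(suc (q + R)) + a} {(q + q + (i + i) + R + 4) + a′} (a′ + a′)
          (≤-reflexive s≡ ⊹ ≤-reflexive a+a′≡ ⊹ R-≤) (solve (R ∷ a ∷ a′ ∷ i ∷ q ∷ s ∷ [])))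
                         (by {q + q + (i + i) + R + 4} {(suc (q + R)) + a + a′} 0 (≤-reflexive (sym s≡) ⊹
                             ≤-reflexive (sym a+a′≡) ⊹ R-≥) (solve (R ∷ a ∷ a′ ∷ i ∷ q ∷ s ∷ []))))
    -- No pendant precedes the opposite one. The apex takes over: for `s` = 0 its feet are P + R - 1
    -- and P + R, and it blocks 2p = P - 1.
    ... | zero , inj₁ s≡0 = apex-centre
      (weaken (by {b + (suc (a′ + 1))} {R} 1 (b<a ⊹ ≤-reflexive a+a′≡) (solve (R ∷ a ∷ a′ ∷ b ∷ [])))
        (turn refl (arc (q + q + 2 + m) (P + x₁)
            (by {q + q + 2 + m} {(suc (q + R)) + x₁ + b} s (≤-reflexive (sym x₁≡) ⊹ R-≥)
                (solve (R ∷ b ∷ m ∷ q ∷ s ∷ x₁ ∷ [])))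
            (by {(suc (q + R)) + x₁} {q + q + 2 + m + b} (b + b) (≤-reflexive x₁≡ ⊹ ≤-reflexive s≡0 ⊹ R-≤)
                (solve (R ∷ b ∷ m ∷ q ∷ s ∷ x₁ ∷ []))))
          ▷ w
          ▷ arc (P + a) (suc X) (by {(suc (q + R)) + a} {(suc (q + q + 2 + R)) + a′} (a′ + a′)
              (≤-reflexive s≡0 ⊹ ≤-reflexive a+a′≡ ⊹ R-≤) (solve (R ∷ a ∷ a′ ∷ q ∷ s ∷ [])))
                                (by {suc (q + q + 2 + R)} {(suc (q + R)) + a + a′} s (≤-reflexive (sym a+a′≡)
                                    ⊹ R-≥) (solve (R ∷ a ∷ a′ ∷ q ∷ s ∷ [])))
          ▷ apex-walk₂))
    -- The opposite foot P + R + 1 may be one step too far from P + a. The preceding foot is P + R -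
    -- 1, missed by P - 1.
    ... | suc i , inj₁ s≡ = end a′ a+a′≡
      where
      from : W b (cyc (c (q + R))) (cyc (c (P + x₁)))
      from = turn refl (arc (q + R + m) (P + x₁) (by {q + R + m} {(suc (q + R)) + x₁ + b} 0
          (≤-reflexive (sym x₁≡)) (solve (R ∷ b ∷ m ∷ q ∷ x₁ ∷ [])))
                                                 (by {(suc (q + R)) + x₁} {q + R + m + b} (b + b)
                                                     (≤-reflexive x₁≡) (solve (R ∷ b ∷ m ∷ q ∷ x₁ ∷ []))))
      via : ∀ k → b + suc (k + 1) ≤ R → W k (cyc (c (P + a))) (cyc (c (L i))) → Centre
      via k k≤R = via-pend (q + R) i b k (by {i} {s} (i + 2) (≤-reflexive (sym s≡)) (solve (i ∷ s ∷ [])))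
        (by {q + q + 3 + (i + i)} {q + R} 1 (≤-reflexive (sym s≡) ⊹ R-≥) (solve (R ∷ i ∷ q ∷ s ∷ [])))
            (by {q + R} {q + q + 4 + (i + i)} 0 (≤-reflexive s≡ ⊹ R-≤) (solve (R ∷ i ∷ q ∷ s ∷ [])))
        k≤R from w
      end : ∀ a′ → a + a′ ≡ R → Centre
      -- With `a` = `R` the chord overshoots the foot by one.
      end zero a+0≡ = via 1 (by {b + 3} {R} 0 (b<a ⊹ ≤-reflexive a+0≡) (solve (R ∷ a ∷ b ∷ [])))
        (arc (P + a) (L i) (by {(suc (q + R)) + a} {(q + q + (i + i) + R + 4) + 1} 0
            (≤-reflexive s≡ ⊹ ≤-reflexive a+0≡ ⊹ R-≤) (solve (R ∷ a ∷ i ∷ q ∷ s ∷ [])))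
                           (by {q + q + (i + i) + R + 4} {(suc (q + R)) + a + 1} 2 (≤-reflexive (sym s≡) ⊹
                               ≤-reflexive (sym a+0≡) ⊹ R-≥) (solve (R ∷ a ∷ i ∷ q ∷ s ∷ []))))
      end (suc a″) a+sa″≡ = via a″ (by {b + (suc (a″ + 1))} {R} 2 (b<a ⊹ ≤-reflexive a+sa″≡)
          (solve (R ∷ a ∷ a″ ∷ b ∷ [])))
        (arc (P + a) (L i) (by {(suc (q + R)) + a} {(q + q + (i + i) + R + 4) + a″} (a″ + a″)
            (≤-reflexive s≡ ⊹ ≤-reflexive a+sa″≡ ⊹ R-≤) (solve (R ∷ a ∷ a″ ∷ i ∷ q ∷ s ∷ [])))
                           (by {q + q + (i + i) + R + 4} {(suc (q + R)) + a + a″} 0 (≤-reflexive (sym s≡) ⊹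
                               ≤-reflexive (sym a+sa″≡) ⊹ R-≥) (solve (R ∷ a ∷ a″ ∷ i ∷ q ∷ s ∷ []))))

    chord-rl : ∀ {x₂ b a a′} → x₂ + a ≡ m → suc b + 2 ≤ a → a + a′ ≡ R → Chord (suc b) x₂
    chord-rl {x₂} {b} {a} {a′} x₂≡ b<a a+a′≡ w with parity s
    ... | i , inj₁ s≡ = via-pend P i (suc b) a′ (by {i} {s} i (≤-reflexive (sym s≡)) (solve (i ∷ s ∷ [])))
      (by {q + q + 3 + (i + i)} {suc (q + R)} 0 (≤-reflexive (sym s≡) ⊹ R-≥) (solve (R ∷ i ∷ q ∷ s ∷ [])))
          (by {suc (q + R)} {q + q + 4 + (i + i)} 1 (≤-reflexive s≡ ⊹ R-≤) (solve (R ∷ i ∷ q ∷ s ∷ [])))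
      (by {(suc b) + (suc (a′ + 1))} {R} 0 (b<a ⊹ ≤-reflexive a+a′≡) (solve (R ∷ a ∷ a′ ∷ b ∷ [])))
      (arc P (P + suc b) (slack {suc (q + R)} {(suc (q + R)) + (suc b) + (suc b)} (b + b + 2)
          (solve (R ∷ b ∷ q ∷ []))) (slack {(suc (q + R)) + (suc b)} {(suc (q + R)) + (suc b)} 0
          (solve (R ∷ b ∷ q ∷ [])))) w
      (arc (P + x₂) (L i) (by {(suc (q + R)) + x₂} {(q + q + (i + i) + R + 4) + a′} 0
          (≤-reflexive s≡ ⊹ ≤-reflexive x₂≡ ⊹ ≤-reflexive (sym a+a′≡) ⊹ R-≤ ⊹ m-≤)
          (solve (R ∷ a ∷ a′ ∷ i ∷ m ∷ q ∷ s ∷ x₂ ∷ [])))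
                          (by {q + q + (i + i) + R + 4} {(suc (q + R)) + x₂ + a′} (a′ + a′)
                              (≤-reflexive (sym s≡) ⊹ ≤-reflexive (sym x₂≡) ⊹ ≤-reflexive a+a′≡ ⊹ R-≥ ⊹ m-≥)
                              (solve (R ∷ a ∷ a′ ∷ i ∷ m ∷ q ∷ s ∷ x₂ ∷ []))))
    -- The mirror image of the even case of `chord-lr`: the next foot P + R + 2 lies R - 1 before
    -- `P` modulo `m`, and it exists as `s` is odd.
    ... | i , inj₂ s≡ = end a′ a+a′≡
      where
      via : ∀ k → b + suc (k + 1) ≤ R → W k (cyc (c (P + x₂))) (cyc (c (L (suc i)))) → Centre
      via k k≤R = via-pend (P + 1) (suc i) b k (by {suc i} {s} i (≤-reflexive (sym s≡)) (solve (i ∷ s ∷ [])))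
        (by {q + q + 3 + ((suc i) + (suc i))} {(suc (q + R)) + 1} 0 (≤-reflexive (sym s≡) ⊹ R-≥)
            (solve (R ∷ i ∷ q ∷ s ∷ []))) (by {(suc (q + R)) + 1} {q + q + 4 + ((suc i) + (suc i))} 1
            (≤-reflexive s≡ ⊹ R-≤) (solve (R ∷ i ∷ q ∷ s ∷ [])))
        k≤R (arc (P + 1) (P + suc b) (slack {(suc (q + R)) + 1} {(suc (q + R)) + (suc b) + b} (b + b)
            (solve (R ∷ b ∷ q ∷ []))) (slack {(suc (q + R)) + (suc b)} {(suc (q + R)) + 1 + b} 0
            (solve (R ∷ b ∷ q ∷ [])))) w
      end : ∀ a′ → a + a′ ≡ R → Centre
      end zero a+0≡ = via 1 (by {b + 3} {R} 0 (b<a ⊹ ≤-reflexive a+0≡) (solve (R ∷ a ∷ b ∷ [])))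
        (arc (P + x₂) (L (suc i))
          (by {(suc (q + R)) + x₂} {(q + q + ((suc i) + (suc i)) + R + 4) + 1} 2
              (≤-reflexive s≡ ⊹ ≤-reflexive x₂≡ ⊹ ≤-reflexive (sym a+0≡) ⊹ R-≤ ⊹ m-≤)
              (solve (R ∷ a ∷ i ∷ m ∷ q ∷ s ∷ x₂ ∷ [])))
          (by {q + q + ((suc i) + (suc i)) + R + 4} {(suc (q + R)) + x₂ + 1} 0 (≤-reflexive (sym s≡) ⊹
              ≤-reflexive (sym x₂≡) ⊹ ≤-reflexive a+0≡ ⊹ R-≥ ⊹ m-≥) (solve (R ∷ a ∷ i ∷ m ∷ q ∷ s ∷ x₂ ∷ []))))
      end (suc a″) a+sa″≡ = via a″ (by {b + (suc (a″ + 1))} {R} 2 (b<a ⊹ ≤-reflexive a+sa″≡)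
          (solve (R ∷ a ∷ a″ ∷ b ∷ [])))
        (arc (P + x₂) (L (suc i))
          (by {(suc (q + R)) + x₂} {(q + q + ((suc i) + (suc i)) + R + 4) + a″} 0
              (≤-reflexive s≡ ⊹ ≤-reflexive x₂≡ ⊹ ≤-reflexive (sym a+sa″≡) ⊹ R-≤ ⊹ m-≤)
              (solve (R ∷ a ∷ a″ ∷ i ∷ m ∷ q ∷ s ∷ x₂ ∷ [])))
          (by {q + q + ((suc i) + (suc i)) + R + 4} {(suc (q + R)) + x₂ + a″} (a″ + a″) (≤-reflexive (sym s≡) ⊹
              ≤-reflexive (sym x₂≡) ⊹ ≤-reflexive a+sa″≡ ⊹ R-≥ ⊹ m-≥)
              (solve (R ∷ a ∷ a″ ∷ i ∷ m ∷ q ∷ s ∷ x₂ ∷ []))))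

    chord : ∀ {x₁ x₂ t₁ t₂} → x₁ < m → x₂ < m → Side x₁ t₁ → Side x₂ t₂ → t₁ + 2 ≤ t₂ → Chord x₁ x₂
    -- A chord at `P` itself, which is `node 0`, shortens a route to the end of the path.
    chord {zero} {x₂} {t₂ = t₂} _ x₂<m (right _) side₂ gap w = leg-shortcut x₂ 0 x₂<m z≤n
      (bounds gap side₂ .proj₁) (bounds gap side₂ .proj₂) (s≤s z≤n) ≤-refl
      (back (subst (λ t → W 1 (cyc (c t)) (cyc (c (P + x₂)))) (+-identityʳ P) w))
      where
      bounds : ∀ {t₂} → 2 ≤ t₂ → Side x₂ t₂ → 2 ≤ x₂ + 0 × suc (x₂ + 1) ≤ m + 0
      bounds 2≤x (right x≤R) = (by {2} {x₂ + 0} 0 2≤x (solve (x₂ ∷ []))) , (by {suc (x₂ + 1)} {m + 0}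
          (q + s + 1) (x≤R ⊹ R-≥ ⊹ m-≥) (solve (R ∷ m ∷ q ∷ s ∷ x₂ ∷ [])))
      bounds {t₂} 2≤t (left x+t≡ t≤R) = (by {2} {x₂ + 0} (q + s + 1) (≤-reflexive (sym x+t≡) ⊹ t≤R ⊹ R-≥ ⊹ m-≥)
          (solve (R ∷ m ∷ q ∷ s ∷ t₂ ∷ x₂ ∷ []))) ,
        (by {suc (x₂ + 1)} {m + 0} 0 (≤-reflexive x+t≡ ⊹ 2≤t) (solve (m ∷ t₂ ∷ x₂ ∷ [])))
    chord {x₁} x₁<m _ (left {b = zero} x₁+0≡m _) _ _ _ =
      contradiction (trans (sym (+-identityʳ x₁)) x₁+0≡m) (<⇒≢ x₁<m)
    chord {suc _} _ _ (right _) (right a≤R) gap = chord-rr gap (m≤n⇒∃[o]m+o≡n a≤R .proj₂)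
    chord {suc _} _ _ (right _) (left x₂≡ a≤R) gap = chord-rl x₂≡ gap (m≤n⇒∃[o]m+o≡n a≤R .proj₂)
    chord _ _ (left {b = suc _} x₁≡ _) (right a≤R) gap = chord-lr x₁≡ gap (m≤n⇒∃[o]m+o≡n a≤R .proj₂)
    chord _ _ (left {b = suc _} x₁≡ _) (left x₂≡ a≤R) gap = chord-ll x₁≡ x₂≡ gap (m≤n⇒∃[o]m+o≡n a≤R .proj₂)

    -- Only for two cycle vertices is more of steepness used than that the pair is neither equal nor
    -- adjacent in the base graph.
    shortcut : ∀ {a b} → OK a → OK b → Steep a b → W 1 a b → Centre
    shortcut (cyc y<m) (cyc z<m) g w with chart-of P y<m | chart-of P z<m
    ... | chart _ x₁<m pot₁ | chart _ x₂<m pot₂ with g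
    ...   | inj₁ gap = chord x₁<m x₂<m (side x₁<m) (side x₂<m) (gap-tri _ _ pot₁ pot₂ gap) w
    ...   | inj₂ gap = chord x₂<m x₁<m (side x₂<m) (side x₁<m) (gap-tri _ _ pot₂ pot₁ gap) (back w)
    shortcut (cyc z<m) (leg {i} i≤q) g w with chart-of P z<m
    ... | chart x x<m pot≡ = leg-cyc i≤q x<m (apart (m∸n+n≡m i≤q) (m⊓n≤m x (m ∸ x))
            (subst (λ t → suc q + t + 2 ≤ q ∸ i ⊎ q ∸ i + 2 ≤ suc q + t) pot≡ g)) w
      where
      apart : ∀ {u t} → u + i ≡ q → t ≤ x → suc q + t + 2 ≤ u ⊎ u + 2 ≤ suc q + t → 1 ≤ x + i
      apart {u} {t} u+i≡ t≤x (inj₁ gap) = (by {1} {x + i} (i + i + t + x + 2) (≤-reflexive u+i≡ ⊹ gap)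
          (solve (i ∷ q ∷ t ∷ u ∷ x ∷ [])))
      apart {u} {t} u+i≡ t≤x (inj₂ gap) = (by {1} {x + i} 0 (≤-reflexive (sym u+i≡) ⊹ t≤x ⊹ gap)
          (solve (i ∷ q ∷ t ∷ u ∷ x ∷ [])))
    shortcut (cyc z<m) apex g w with chart-of X z<m
    ... | chart zero _ _ = contradiction (apex₁ (cong c (+-identityʳ X))) (steep-St g)
    ... | chart (suc zero) _ _ = contradiction (apex₂ (cong c (+-comm X 1))) (steep-St g)
    ... | chart x@(suc (suc _)) x<m _ = apex-shortcut x x<m (s≤s (s≤s z≤n)) w
    shortcut (cyc z<m) (pend {j} j≤s) g w with chart-of (L j) z<m
    ... | chart zero _ _ = contradiction (twig {j = j} (cong c (+-identityʳ (L j)))) (steep-St g)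
    ... | chart x@(suc _) x<m _ = pend-shortcut j x j≤s (s≤s z≤n) (≤-trans (≤-reflexive (+-comm x 1)) x<m) w
    shortcut (leg {i} i≤q) (leg {j} j≤q) g w with g
    ... | inj₁ gap = leg-leg i≤q (drop (m∸n+n≡m i≤q) (m∸n+n≡m j≤q) gap) (back w)
    ... | inj₂ gap = leg-leg j≤q (drop (m∸n+n≡m j≤q) (m∸n+n≡m i≤q) gap) w
    shortcut (leg i≤q) apex _ w = leg-apex i≤q (back w)
    shortcut (leg i≤q) (pend j≤s) _ w = leg-pend i≤q j≤s (back w)
    shortcut apex apex g _ = contradiction g (steep-irrefl apex)
    shortcut apex (pend j≤s) _ w = pend-apex j≤s w
    shortcut (pend {j} j≤s) (pend {k} k≤s) g w with <-cmp j k
    ... | tri< j<k _ _    = pend-pend k≤s j<k (back w)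
    ... | tri≈ _ refl _   = contradiction g (steep-irrefl (pend j))
    ... | tri> _ _ k<j    = pend-pend j≤s k<j w
    shortcut a@(leg _) b@(cyc _) g w = shortcut b a (⊎-swap g) (back w)
    shortcut a@apex b@(cyc _) g w = shortcut b a (⊎-swap g) (back w)
    shortcut a@apex b@(leg _) g w = shortcut b a (⊎-swap g) (back w)
    shortcut a@(pend _) b@(cyc _) g w = shortcut b a (⊎-swap g) (back w)
    shortcut a@(pend _) b@(leg _) g w = shortcut b a (⊎-swap g) (back w)
    shortcut a@(pend _) b@apex g w = shortcut b a (⊎-swap g) (back w)

    -- The only vertex that position 2p misses is the apex, one step beyond `R`.
    central : ∀ {w} → OK w → W (suc R) (cyc (c (q + q + 2))) w
    central ok with close (q + q + 2) (by {suc (q + q + 2)} {m} (s + s + 2) (R-≥ ⊹ R-≥ ⊹ m-≥)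
        (solve (R ∷ m ∷ q ∷ s ∷ []))) ok
    central _    | inj₁ p = weaken (n≤1+n R) p
    central apex | inj₂ _ = weaken (≤-reflexive (+-comm R 1)) (round (c<m _) (c<m X) ▷ apex-walk₁)
    central _    | inj₂ (leg 2p<2p) = contradiction 2p<2p (<-irrefl refl)
    central _    | inj₂ (pend {j} lower _) =
      contradiction (by {suc (q + q + 2)} {q + q + 2} (j + j) lower (solve (j ∷ q ∷ []))) 1+n≰n

    descend : ∀ {w} → OK w → W (suc q) (cyc (base w)) w
    descend (cyc _)    = stay
    descend (leg i≤q)  = weaken (s≤s i≤q) (leg-walk i≤q)
    descend apex       = weaken (s≤s z≤n) apex-walk₁
    descend (pend j≤s) = weaken (s≤s z≤n) (twig-walk j≤s)

    low : ∀ {w} → OK w → W 1 (cyc (base w)) w ⊎ ∃ λ i → i ≤ q × w ≡ leg i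
    low (cyc _)       = inj₁ stay
    low (leg {i} i≤q) = inj₂ (i , i≤q , refl)
    low apex          = inj₁ apex-walk₁
    low (pend j≤s)    = inj₁ (twig-walk j≤s)

    -- Unless both vertices lie on the path, one is within 1 of its foot and the other within q + 1;
    -- the feet are within `R`.
    join : ∀ {a b} → OK a → OK b → W (suc (suc (R + q))) a b
    join a b with low a | low b
    ... | inj₁ p | _ = weaken (slack {1 + (R + (suc q))} {suc (suc (R + q))} 0 (solve (R ∷ q ∷ [])))
        (back p ▷ round (base<m a) (base<m b) ▷ descend b)
    ... | _ | inj₁ p = weaken (slack {(suc q) + (R + 1)} {suc (suc (R + q))} 0 (solve (R ∷ q ∷ [])))
        (back (descend a) ▷ round (base<m a) (base<m b) ▷ p)
    ... | inj₂ (i , i≤q , refl) | inj₂ (j , j≤q , refl) = along (suc i) (suc j) (s≤s i≤q) (s≤s j≤q)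
      (by {suc i} {(suc j) + (suc (suc (R + q)))} (R + j + 2) i≤q (solve (R ∷ i ∷ j ∷ q ∷ [])))
          (by {suc j} {(suc i) + (suc (suc (R + q)))} (R + i + 2) j≤q (solve (R ∷ i ∷ j ∷ q ∷ [])))

-- The e surplus vertices of the graph are non-adjacent twins of position 0 on the cycle.
clamp : ∀ e {m} → Fin (e + m) → ℕ
clamp e = [ (λ _ → 0) , toℕ ]′ ∘ splitAt e

clamp<m : ∀ e {m} → 0 < m → ∀ i → clamp e {m} i < m
clamp<m e 0<m i with splitAt e i
... | inj₁ _ = 0<m
... | inj₂ j = toℕ<n j

clamp-onto : ∀ e {m b} → b < m → ∃ λ i → clamp e {m} i ≡ b
clamp-onto e {m} b<m = e ↑ʳ fromℕ< b<m ,
  trans (cong [ (λ _ → 0) , toℕ ]′ (splitAt-↑ʳ e m (fromℕ< b<m))) (toℕ-fromℕ< b<m)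

-- Diameter equal to the radius: an even cycle with twins

module EvenCycle (k e : ℕ) where
  m : ℕ
  m = suc k + suc k

  open Ring m

  φ : Fin (e + m) → ℕ
  φ = clamp e

  φ<m : ∀ i → φ i < m
  φ<m = clamp<m e (s≤s z≤n)

  open Pullback _≟ⁿ_ {_< m} next? (λ _ → next-irrefl (s≤s (≤-trans (s≤s z≤n) (m≤n+m (suc k) k)))) φ φ<m

  self-centred : 1 ≤ k → Realized (suc k) (suc k) (e + m)
  self-centred 1≤k = radiallyMaximal-above graph k k 1≤k far (i₀ , close i₀) close λ H _ ¬c → beyond H ¬c
    where
    i₀ : Fin (e + m)
    i₀ = clamp-onto e {m} {0} (s≤s z≤n) .proj₁
    ρ₀ : ∃ Section
    ρ₀ = section (clamp-onto e) i₀
    twins : ∀ i j → φ i ≡ φ j → Within graph 2 i j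
    twins i j φi≡φj =
      let l , φl≡ = clamp-onto e (c<m (suc (φ i)))
      in  within-trans {v = l} (within-edge (edge φl≡))
            (within-sym (within-edge (edge (trans φl≡ (cong (c ∘ suc) φi≡φj)))))
    close : ∀ i j → Within graph (suc k) i j
    close i j = spread (λ _ _ uv → uv) (ρ₀ .proj₂) (s≤s 1≤k) twins i j λ sec →
      Walk.half (reach (λ _ _ uv → uv) sec) (n≤1+n m) (φ<m i) (φ<m j)
    far : ¬ Central graph k
    far (v , all) =
      -- The position antipodal to that of `v`.
      let t = φ v + suc k
          w , φw≡ = clamp-onto e (c<m t)
          high = pot-≥ (φ v) t (suc k) (sym (+-assoc (φ v) (suc k) (suc k))) ≤-refl ≤-refl
              (m<m+n (suc k) (s≤s z≤n))
          near = within-lipschitz (graph-lipschitz (pot-lipschitz t)) (all w)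
      in  1+n≰n (≤-trans (subst (λ b → suc k ≤ pot t b) (c-id (φ<m v)) high)
            (subst (pot t (φ v) ≤_) (trans (cong (k +_) (trans (cong (pot t) φw≡) (pot-self t)))
                (+-identityʳ k)) near))
    beyond : ∀ H → ¬ Central H k → ∃ λ u → ∃ λ v → ¬ Within H k u v
    beyond H ¬c = i₀ , some-beyond λ all → ¬c (i₀ , all)

-- Diameter above the radius: the base graph with twins

module SunGraph (q s e : ℕ) where
  R m n : ℕ
  R = q + s + 2
  m = suc (R + R)
  n = (e + m) + (suc q + (1 + suc s))

  open Ring m
  open Sun q s R m refl refl

  Index : Set
  Index = Fin (e + m) ⊎ (Fin (suc q) ⊎ (Fin 1 ⊎ Fin (suc s)))

  layout : Fin n ↔ Index
  layout = ↔-trans +↔⊎ (↔-refl ⊎-↔ ↔-trans +↔⊎ (↔-refl ⊎-↔ +↔⊎))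

  open Inverse layout using (to; from; strictlyInverseˡ)

  decode : Index → Vertex
  decode (inj₁ i)               = cyc (clamp e i)
  decode (inj₂ (inj₁ i))        = leg (toℕ i)
  decode (inj₂ (inj₂ (inj₁ _))) = apex
  decode (inj₂ (inj₂ (inj₂ j))) = pend (toℕ j)

  decode-OK : ∀ x → OK (decode x)
  decode-OK (inj₁ i)               = cyc (clamp<m e (s≤s z≤n) i)
  decode-OK (inj₂ (inj₁ i))        = leg (≤-pred (toℕ<n i))
  decode-OK (inj₂ (inj₂ (inj₁ _))) = apex
  decode-OK (inj₂ (inj₂ (inj₂ j))) = pend (≤-pred (toℕ<n j))

  decode-onto : ∀ {a} → OK a → ∃ λ x → decode x ≡ a
  decode-onto (cyc b<m)  = let i , i≡ = clamp-onto e b<m in inj₁ i , cong cyc i≡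
  decode-onto (leg i≤q)  = inj₂ (inj₁ (fromℕ< (s≤s i≤q))) , cong leg (toℕ-fromℕ< (s≤s i≤q))
  decode-onto apex       = inj₂ (inj₂ (inj₁ zero)) , refl
  decode-onto (pend j≤s) = inj₂ (inj₂ (inj₂ (fromℕ< (s≤s j≤s)))) , cong pend (toℕ-fromℕ< (s≤s j≤s))

  decode-injective : ∀ x y → decode x ≡ decode y → x ≡ y ⊎ ∃ λ b → decode x ≡ cyc b
  decode-injective (inj₁ i) _ _ = inj₂ (_ , refl)
  decode-injective (inj₂ (inj₁ i)) (inj₂ (inj₁ j)) e = inj₁ (cong (inj₂ ∘ inj₁)
      (toℕ-injective (leg-injective e)))
    where
    leg-injective : ∀ {i j} → leg i ≡ leg j → i ≡ j
    leg-injective refl = refl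
  decode-injective (inj₂ (inj₂ (inj₁ zero))) (inj₂ (inj₂ (inj₁ zero))) _ = inj₁ refl
  decode-injective (inj₂ (inj₂ (inj₂ i))) (inj₂ (inj₂ (inj₂ j))) e =
    inj₁ (cong (inj₂ ∘ inj₂ ∘ inj₂) (toℕ-injective (pend-injective e)))
    where
    pend-injective : ∀ {i j} → pend i ≡ pend j → i ≡ j
    pend-injective refl = refl
  decode-injective (inj₂ (inj₁ _)) (inj₂ (inj₂ (inj₁ _))) ()
  decode-injective (inj₂ (inj₁ _)) (inj₂ (inj₂ (inj₂ _))) ()
  decode-injective (inj₂ (inj₂ (inj₁ _))) (inj₂ (inj₂ (inj₂ _))) ()
  decode-injective (inj₂ (inj₂ (inj₂ _))) (inj₂ (inj₂ (inj₁ _))) ()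

  φ : Fin n → Vertex
  φ = decode ∘ to

  φ-OK : ∀ i → OK (φ i)
  φ-OK i = decode-OK (to i)

  φ-onto : ∀ {a} → OK a → ∃ λ i → φ i ≡ a
  φ-onto ok = let x , x≡ = decode-onto ok in from x , trans (cong decode (strictlyInverseˡ x)) x≡

  φ-injective : ∀ i j → φ i ≡ φ j → i ≡ j ⊎ ∃ λ b → φ i ≡ cyc b
  φ-injective i j e = map₁ (Injection.injective (↔⇒↣ layout)) (decode-injective (to i) (to j) e)

  open Pullback _≟ⱽ_ {OK} St? St-irrefl φ φ-OK

  ρ₀ : ∃ Section
  ρ₀ = section φ-onto (φ-onto apex .proj₁)

  ⊑-refl : graph ⊑ graph
  ⊑-refl _ _ uv = uv

  twins : ∀ i j → φ i ≡ φ j → Within graph 2 i j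
  twins i j φi≡φj with φ-injective i j φi≡φj
  ... | inj₁ refl = here
  ... | inj₂ (b , φi≡b) =
    let l , φl≡ = φ-onto (cyc (c<m (suc b)))
        step-to = λ {i′} (e : φ i′ ≡ cyc b) → within-edge {u = i′} {l}
            (edge (subst₂ St (sym e) (sym φl≡) (ring refl)))
    in  within-trans (step-to φi≡b) (within-sym (step-to (trans (sym φi≡φj) φi≡b)))

  close : ∀ {k H} → graph ⊑ H → 2 ≤ k → ∀ i j →
          (∀ {W} → Reach OK St W → W k (φ i) (φ j)) → Within H k i j
  close {H = H} G⊑H 2≤k i j via = spread G⊑H (ρ₀ .proj₂) 2≤k
    (λ i j e → within-⊑ {H = H} G⊑H (twins i j e)) i j λ sec → via (reach G⊑H sec)

  2≤R : 2 ≤ R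
  2≤R = m≤n+m 2 (q + s)

  not-central : ¬ Central graph R
  not-central (v , all) =
    let a , ok , g , lip , ga≡0 , R<g = far (φ-OK v)
        w , φw≡a = φ-onto ok
        near = within-lipschitz (graph-lipschitz lip) (all w)
    in  <⇒≱ R<g (subst (g (φ v) ≤_) (trans (cong (R +_) (trans (cong g φw≡a) ga≡0)) (+-identityʳ R)) near)

  central-suc : Central graph (suc R)
  central-suc =
    let v , φv≡ = φ-onto (cyc (c<m (q + q + 2)))
    in  v , λ w → close ⊑-refl (m≤n⇒m≤1+n 2≤R) v w λ {W} r →
          subst (λ a → W (suc R) a (φ w)) (sym φv≡) (Walks.central r (φ-OK w))

  -- Representatives are chosen to include both `u` and `v`, so the edge becomes a step between
  -- positions and `shortcut` applies.
  no-shortcut : ∀ {H} → graph ⊑ H → ¬ Central H R → ∀ u v → adj H u v ≡ true → ¬ level (φ v) + 2 ≤ level (φ u)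
  no-shortcut {H} G⊑H ¬c u v uv gap = ¬c (ρ (cyc (c τ)) , covers)
    where
    ρ = (ρ₀ .proj₁ fixing v) fixing u
    sec : Section ρ
    sec = fixing-section {ρ₀ .proj₁ fixing v} u (fixing-section {ρ₀ .proj₁} v (ρ₀ .proj₂))
    φv≢φu : φ v ≢ φ u
    φv≢φu e = m+1+n≰m (level (φ v)) (subst (λ a → level (φ v) + 2 ≤ level a) (sym e) gap)
    jump : Via G⊑H ρ 1 (φ u) (φ v)
    jump = subst₂ (Within H 1) (sym (fixing-at (ρ₀ .proj₁ fixing v) u))
      (sym (trans (fixing-off (ρ₀ .proj₁ fixing v) u φv≢φu) (fixing-at (ρ₀ .proj₁) v))) (within-edge uv)
    centre = Walks.shortcut (reach G⊑H sec) (φ-OK u) (φ-OK v) (inj₂ gap) jump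
    τ = centre .proj₁
    covers : ∀ w → Within H R (ρ (cyc (c τ))) w
    covers w with φ-injective w (ρ (φ w)) (sym (sec (φ-OK w)))
    ... | inj₁ w≡ = subst (Within H R _) (sym w≡) (centre .proj₂ (φ-OK w))
    -- Here `w` may be a twin that `ρ` does not choose; cycle positions are within `R` of each other
    -- for every choice.
    ... | inj₂ (b , φw≡b) = close G⊑H 2≤R _ w λ {W} r →
      subst₂ (W R) (sym (sec (cyc (c<m τ)))) (sym φw≡b) (Walks.round r (c<m τ)
          (base<m (subst OK φw≡b (φ-OK w))))

  non-self-centred : Realized (suc R) (suc (suc (R + q))) n
  non-self-centred = radiallyMaximal-above graph R (suc (R + q)) (s≤s z≤n) not-central central-suc
    (λ i j → close ⊑-refl (s≤s (s≤s z≤n)) i j λ r → Walks.join r (φ-OK i) (φ-OK j)) apart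
    where
    apart : ∀ H → graph ⊑ H → ¬ Central H R → ∃ λ u → ∃ λ v → ¬ Within H (suc (R + q)) u v
    apart H G⊑H ¬c =
      let j , j≤s , high = opposite
          u , φu≡ = φ-onto (pend j≤s)
          v , φv≡ = φ-onto (leg {q} ≤-refl)
          smooth = λ u v uv → ≮⇒≥ λ steep → no-shortcut G⊑H ¬c u v uv (subst (_≤ level (φ u))
              (+-comm 2 _) steep)
      in  u , v , λ p → 1+n≰n (≤-trans (subst (λ a → _ ≤ level a) (sym φu≡) high)
            (subst (level (φ u) ≤_) (trans (cong (suc (R + q) +_) (trans (cong level φv≡) (n∸n≡0 q)))
                (+-identityʳ _))
              (within-lipschitz smooth p)))

-- Matching the parameters of the theorem

self-centred : ∀ k n → 1 ≤ k → 2 * suc k ≤ n → Realized (suc k) (suc k) n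
self-centred k n 1≤k 2r≤n with m≤n⇒∃[o]m+o≡n 2r≤n
... | e , refl = subst (Realized (suc k) (suc k)) order (EvenCycle.self-centred k e 1≤k)
  where
  order : e + (suc k + suc k) ≡ 2 * suc k + e
  order = (solve (e ∷ k ∷ []))

non-self-centred : ∀ k d n → suc k < d → d ≤ 2 * k → 2 + 3 * k ≤ n → Realized (suc k) d n
non-self-centred k d n r<d d≤2k 2+3k≤n with m≤n⇒∃[o]m+o≡n r<d
... | q , refl
  -- The bound on `d` says exactly that `s` exists, so that at least one of the s + 1 pendants is
  -- present.
  with m≤n⇒∃[o]m+o≡n {q + 2} {k} (by {q + 2} {k} 0 d≤2k (solve (k ∷ q ∷ []))) | m≤n⇒∃[o]m+o≡n 2+3k≤n
...   | s , refl | e , refl =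
  subst₂ (λ k n → Realized (suc k) (suc (suc (k + q))) n) radius order (SunGraph.non-self-centred q s e)
  where
  radius : q + s + 2 ≡ q + 2 + s
  radius = (solve (q ∷ s ∷ []))
  order : e + suc (q + s + 2 + (q + s + 2)) + (suc q + (1 + suc s)) ≡ 2 + 3 * (q + 2 + s) + e
  order = (solve (e ∷ q ∷ s ∷ []))

theorem2 : (∀ r n → 1 ≤ r → 1 ≤ n → 2 ≤ r → 2 * r ≤ n →
    ∃ λ (G : Graph n) → Connected G × RadiallyMaximal G × HasRadius G r × HasDiameter G r)
    × (∀ r d n → 1 ≤ r → 1 ≤ d → 1 ≤ n → r < d → d ≤ 2 * r ∸ 2 → 3 * r ∸ 1 ≤ n →
    ∃ λ (G : Graph n) → Connected G × RadiallyMaximal G × HasRadius G r × HasDiameter G d)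
theorem2 =
  (λ { (suc k) n _ _ (s≤s 1≤k) 2r≤n → self-centred k n 1≤k 2r≤n }) ,
  (λ { (suc k) d n _ _ _ r<d d≤ ≤n → non-self-centred k d n r<d
         (subst (d ≤_) (cong (_∸ 2) (*-suc 2 k)) d≤) (subst (_≤ n) (cong (_∸ 1) (*-suc 3 k)) ≤n) })
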